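{- For every $n\ge 0$, \[ \nu_2(t_6(n))=\nu_2\binom{n+5}{5}+\mathbf 1_{n\equiv 3\ (\mathrm{mod}\ 4)}. \] Moreover, for every integer $s\ge 1$, the sequence $\bigl(\operatorname{odd}(t_6(n))\bmod 2^s\bigr)_{n\ge 0}$ is $2$-automatic.
   Context: Let $T(x)=\prod_{j\ge 0}(1-x^{2^j})\in\mathbb Z[[x]]$ be the Thue--Morse generating function, and define the integers $t_6(n)$ by $T(x)^6=\sum_{n\ge 0}t_6(n)x^n$. For a nonzero integer $a$, $\nu_2(a)$ is the largest integer $v$ such that $2^v$ divides $a$, and $\nu_2(0)=+\infty$. The signed odd part is $\operatorname{odd}(a)=a/2^{\nu_2(a)}$ for $a\neq 0$ and $\operatorname{odd}(0)=0$. For a statement $\mathcal E$, $\mathbf 1_{\mathcal E}$ is $1$ if $\mathcal E$ holds and $0$ otherwise. A sequence $(a_n)_{n\ge 0}$ with values in a finite set is $2$-automatic if there is a finite automaton which, reading the binary expansion of $n$ from the most significant digit, outputs $a_n$; equivalently, its $2$-kernel $\{(a_{2^e n+c})_{n\ge 0}: e\ge 0,\ 0\le c<2^e\}$ is finite. -}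

module Defs where

import Algebra.Properties.CommutativeMonoid.Sum
open import Data.Bool.Base using (if_then_else_)
open import Data.Digit using (Bit; toDigits)
open import Data.Fin.Base as Fin using (Fin; toℕ; fromℕ<)
import Data.Fin.Properties as Fin
open import Data.Integer.Base as ℤ using (ℤ; +_; 0ℤ; 1ℤ; ∣_∣)
open import Data.Integer.DivMod using (_/ℕ_; n%ℕd<d)
import Data.Integer.Divisibility as ℤ
import Data.Integer.Properties as ℤ
open import Data.List.Base using (List; foldl; reverse)
open import Data.Nat.Base as ℕ using (ℕ; zero; suc; _+_; _∸_; _^_; _≤_; _<_; s≤s; z≤n)
open import Data.Nat.Divisibility using (_∣_; _∣?_; 1∣_; ∣⇒≤)
import Data.Nat.Properties as ℕ
open import Data.Product.Base using (∃; proj₁; _×_; _,_)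
open import Data.Sum.Base using (inj₁; inj₂)
open import Function.Base using (_∘_)
open import Relation.Binary.PropositionalEquality
open import Relation.Nullary using (Dec; does; yes; no; contradiction)
open import Relation.Nullary.Decidable using (dec-false)
open import Relation.Nullary.Construct.Add.Supremum public using (_⁺; ⊤⁺; [_])

module Sumℤ = Algebra.Properties.CommutativeMonoid.Sum ℤ.+-0-commutativeMonoid
open Sumℤ using (sum⁺-syntax)

𝟏 : ∀ {p} {P : Set p} → Dec P → ℕ
𝟏 P? = if does P? then 1 else 0

-- ℤ[[x]]: a series is the function sending n to its coefficient of xⁿ.
Series : Set
Series = ℕ → ℤ

infix  9 X^_
infixl 6 _-ˢ_
infixl 7 _*ˢ_
infixr 8 _^ˢ_

X^_ : ℕ → Series
(X^ k) n = + 𝟏 (n ℕ.≟ k)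

1ˢ : Series
1ˢ = X^ 0

_-ˢ_ : Series → Series → Series
(f -ˢ g) n = f n ℤ.- g n

-- ∑[ i ≤ n ] has n + 1 terms; i ranges over Fin (suc n).
_*ˢ_ : Series → Series → Series
(f *ˢ g) n = ∑[ i ≤ n ] (f (toℕ i) ℤ.* g (n ∸ toℕ i))

_^ˢ_ : Series → ℕ → Series
f ^ˢ zero  = 1ˢ
f ^ˢ suc k = f *ˢ (f ^ˢ k)

partialProduct : ℕ → Series
partialProduct zero    = 1ˢ
partialProduct (suc k) = (1ˢ -ˢ X^ (2 ^ k)) *ˢ partialProduct k

-- The infinite product: since 2^j > n for j ≥ n, the factors with j ≥ n do
-- not affect the coefficient of xⁿ; see T-limit.
T : Series
T n = partialProduct n n

t₆ : ℕ → ℤ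
t₆ = T ^ˢ 6

n<2^n : ∀ n → n < 2 ^ n
n<2^n zero    = s≤s z≤n
n<2^n (suc n) = ℕ.+-mono-≤ (ℕ.m^n>0 2 n) (ℕ.≤-trans (n<2^n n) (ℕ.m≤m+n (2 ^ n) 0))

X^-≢ : ∀ {k n} → n ≢ k → (X^ k) n ≡ 0ℤ
X^-≢ {k} {n} n≢k = cong (λ b → + (if b then 1 else 0)) (dec-false (n ℕ.≟ k) n≢k)

*ˢ-low : ∀ g f n → (∀ {m} → m ≤ n → g m ≡ 1ˢ m) → (g *ˢ f) n ≡ f n
*ˢ-low g f n g≈1 = begin
  g 0 ℤ.* f n ℤ.+ Sumℤ.sum tail  ≡⟨ cong₂ (λ a b → a ℤ.* f n ℤ.+ b) (g≈1 z≤n) tail≡0 ⟩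
  1ℤ ℤ.* f n ℤ.+ 0ℤ              ≡⟨ ℤ.+-identityʳ _ ⟩
  1ℤ ℤ.* f n                     ≡⟨ ℤ.*-identityˡ _ ⟩
  f n                            ∎
  where
  open ≡-Reasoning
  tail : Fin n → ℤ
  tail i = g (suc (toℕ i)) ℤ.* f (n ∸ suc (toℕ i))
  tail≡0 : Sumℤ.sum tail ≡ 0ℤ
  tail≡0 = trans
    (Sumℤ.sum-cong-≗ λ i → cong (ℤ._* f (n ∸ suc (toℕ i))) (g≈1 (Fin.toℕ<n i)))
    (Sumℤ.sum-replicate-zero n)

T-limit : ∀ n d → partialProduct (d + n) n ≡ T n
T-limit n zero    = refl
T-limit n (suc d) = trans (*ˢ-low _ (partialProduct (d + n)) n low) (T-limit n d)
  where
  low : ∀ {m} → m ≤ n → (1ˢ -ˢ X^ (2 ^ (d + n))) m ≡ 1ˢ m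
  low {m} m≤n = trans
    (cong (λ z → 1ˢ m ℤ.- z)
      (X^-≢ (ℕ.<⇒≢ (ℕ.≤-<-trans (ℕ.≤-trans m≤n (ℕ.m≤n+m n d)) (n<2^n (d + n))))))
    (ℤ.+-identityʳ _)

-- The largest v ≤ b with 2^v ∣ m.
maxPow2 : ℕ → ℕ → ℕ
maxPow2 m zero    = 0
maxPow2 m (suc b) = if does (2 ^ suc b ∣? m) then suc b else maxPow2 m b

-- ℕ ⁺ is ℕ with a top element ⊤⁺ standing for +∞.  The search bound ∣ a ∣ is
-- no restriction, since 2^v ∣ a ≠ 0 forces v < 2^v ≤ ∣ a ∣.
ν₂ : ℤ → ℕ ⁺
ν₂ a with ∣ a ∣
... | zero      = ⊤⁺
... | m@(suc _) = [ maxPow2 m m ]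

infixl 6 _+⁺_

_+⁺_ : ℕ ⁺ → ℕ ⁺ → ℕ ⁺
[ m ] +⁺ [ n ] = [ m + n ]
[ _ ] +⁺ ⊤⁺    = ⊤⁺
⊤⁺    +⁺ _     = ⊤⁺

maxPow2-∣ : ∀ m b → 2 ^ maxPow2 m b ∣ m
maxPow2-∣ m zero = 1∣ m
maxPow2-∣ m (suc b) with 2 ^ suc b ∣? m
... | yes p = p
... | no  _ = maxPow2-∣ m b

maxPow2-max : ∀ m b {w} → w ≤ b → 2 ^ w ∣ m → w ≤ maxPow2 m b
maxPow2-max m zero    w≤b _ = w≤b
maxPow2-max m (suc b) w≤b p with 2 ^ suc b ∣? m
... | yes _ = w≤b
... | no ¬q with ℕ.m≤n⇒m<n∨m≡n w≤b
...   | inj₁ (s≤s w≤b′) = maxPow2-max m b w≤b′ p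
...   | inj₂ refl       = contradiction p ¬q

ν₂-largest : ∀ a → a ≢ 0ℤ →
  ∃ λ v → ν₂ a ≡ [ v ] × (+ (2 ^ v)) ℤ.∣ a × (∀ w → (+ (2 ^ w)) ℤ.∣ a → w ≤ v)
ν₂-largest a a≢0 with ∣ a ∣ in eq
... | zero      = contradiction (ℤ.∣i∣≡0⇒i≡0 eq) a≢0
... | m@(suc _) = maxPow2 m m , refl , maxPow2-∣ m m , λ w p →
  maxPow2-max m m (ℕ.<⇒≤ (ℕ.<-≤-trans (n<2^n w) (∣⇒≤ p))) p

-- The integer division by 2^v is exact, as 2^v ∣ a.
odd : ℤ → ℤ
odd a with ν₂ a
... | ⊤⁺    = 0ℤ
... | [ v ] = _/ℕ_ a (2 ^ v) {{ℕ.m^n≢0 2 v}}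

infixl 7 _mod2^_

_mod2^_ : ℤ → (s : ℕ) → Fin (2 ^ s)
a mod2^ s = fromℕ< (n%ℕd<d a (2 ^ s) {{ℕ.m^n≢0 2 s}})

-- toDigits lists the binary digits from the least significant one, without
-- superfluous leading zeros (0 has the expansion "0").
binary : ℕ → List Bit
binary n = reverse (proj₁ (toDigits 2 n))

record Automaton (A : Set) : Set where
  field
    #states : ℕ
    start   : Fin #states
    step    : Fin #states → Bit → Fin #states
    output  : Fin #states → A

  run : List Bit → A
  run = output ∘ foldl step start

Is2Automatic : ∀ {k} → (ℕ → Fin k) → Set
Is2Automatic {k} a = ∃ λ (M : Automaton (Fin k)) → ∀ n → Automaton.run M (binary n) ≡ a n

{-# OPTIONS --safe #-}
module Submission where

-- T(x) = (1 - x) T(x²) gives linear recurrences for the coefficients β of x⁵T⁶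
-- at even and odd places; in particular V(2N) = B V(N) for V(N) = window 5 N =
-- (β N, …, β (N + 4)) and a constant matrix B.  The eigenvalues of B have
-- 2-adic valuations 1, 3, 3, 4, 4, so B / 2 preserves the lattice spanned by
-- the vectors (B / 2)^i B³ v, with v integral and i ≥ 0.  The columns of the
-- matrix D are a basis, so V(8 · 2^e m) = 2^e D u for odd m, where u is an
-- integer vector evolving linearly as binary digits are appended to the index.
-- Every row of D is a power of 2 times a form that is odd at u, so the odd part
-- of t₆ is a linear form, depending on n mod 8, in an integer vector evolving
-- linearly under digit reading; modulo 2^s this is a finite automaton.

open import Defs
import Data.Fin.Properties as Fin
import Data.Integer.Properties as ℤ
import Data.Nat.Properties as ℕ
import Data.Nat.Tactic.RingSolver as ℕ-Solver
import Data.Vec.Properties as Vec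
open import Data.Digit using (Bit; toDigits; fromDigits)
open import Data.Fin using (#_)
open import Data.Fin.Base using (Fin; zero; suc; toℕ; combine; remQuot; funToFin; finToFun)
open import Data.Integer.Base using (+_)
open import Data.Integer.Base as ℤ using (ℤ; -[1+_]; 0ℤ; 1ℤ; _/ℕ_; _%ℕ_; ∣_∣)
open import Data.Integer.DivMod using (a≡a%ℕn+[a/ℕn]*n; n%ℕd<d)
open import Data.Integer.Tactic.RingSolver using (solve-∀)
open import Data.List.Base using (List; []; _∷_; foldr)
open import Data.List.Properties using (reverse-foldl)
open import Data.Nat.Base using (ℕ; _+_; _%_; _≤_)
open import Data.Nat.Base as ℕ using (zero; suc; _*_; _∸_; _^_; _/_; _<_; s≤s; z≤n; _!; NonZero)
open import Data.Nat.Combinatorics using (_C_)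
open import Data.Nat.Combinatorics using (nCk≡n!/k![n-k]!; [n∸k]!k!∣n!)
open import Data.Nat.Divisibility using (_∣_; divides; >⇒∤)
open import Data.Nat.DivMod using (_divMod_; result; m/n*n≡m; [m+kn]%n≡m%n)
open import Data.Nat.Properties using (_≟_)
open import Data.Product.Base using (_×_)
open import Data.Product.Base using (∃; ∃₂; _,_; proj₁; proj₂)
open import Data.Product.Function.NonDependent.Propositional using (_×-↩_)
open import Data.Sum.Base using (_⊎_; inj₁; inj₂; [_,_]′)
open import Data.Vec.Base using (Vec; []; _∷_; _++_; map; zipWith; replicate; take; lookup; tabulate)
open import Function.Base using (_∘_; flip)
open import Function.Bundles using (_↩_; mk↩; module LeftInverse)
open import Function.Construct.Composition using (_↩-∘_)
open import Function.Construct.Identity using (↩-id)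
open import Relation.Binary.PropositionalEquality
open import Relation.Nullary using (contradiction)

-- Even and odd sections of the powers of T

shift : Series → Series
shift f zero    = 0ℤ
shift f (suc n) = f n

shiftBy : ℕ → Series → Series
shiftBy zero    f = f
shiftBy (suc m) f = shift (shiftBy m f)

shift-cong : ∀ {f g} → f ≗ g → shift f ≗ shift g
shift-cong f≗g zero    = refl
shift-cong f≗g (suc n) = f≗g n

shiftBy-cong : ∀ m {f g} → f ≗ g → shiftBy m f ≗ shiftBy m g
shiftBy-cong zero    f≗g = f≗g
shiftBy-cong (suc m) f≗g = shift-cong (shiftBy-cong m f≗g)

shiftBy-neg : ∀ m f n → shiftBy m (ℤ.-_ ∘ f) n ≡ ℤ.- shiftBy m f n
shiftBy-neg zero    f n       = refl
shiftBy-neg (suc m) f zero    = refl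
shiftBy-neg (suc m) f (suc n) = shiftBy-neg m f n

-- Convolution peels off the constant term of the left factor. The identities below follow by
-- induction on `n` with `f` general, passing from `f` to `f ∘ suc`.
*ˢ-unfold : ∀ f g n → (f *ˢ g) n ≡ f 0 ℤ.* g n ℤ.+ shift ((f ∘ suc) *ˢ g) n
*ˢ-unfold f g zero    = refl
*ˢ-unfold f g (suc n) = refl

*ˢ-congˡ : ∀ f {g h} → g ≗ h → f *ˢ g ≗ f *ˢ h
*ˢ-congˡ f g≗h zero    = cong (λ z → f 0 ℤ.* z ℤ.+ 0ℤ) (g≗h 0)
*ˢ-congˡ f g≗h (suc n) =
  cong₂ (λ x y → f 0 ℤ.* x ℤ.+ y) (g≗h (suc n)) (*ˢ-congˡ (f ∘ suc) g≗h n)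

*ˢ-congʳ : ∀ {f f′} g → f ≗ f′ → f *ˢ g ≗ f′ *ˢ g
*ˢ-congʳ g f≗f′ zero    = cong (λ z → z ℤ.* g 0 ℤ.+ 0ℤ) (f≗f′ 0)
*ˢ-congʳ g f≗f′ (suc n) =
  cong₂ (λ x y → x ℤ.* g (suc n) ℤ.+ y) (f≗f′ 0) (*ˢ-congʳ g (f≗f′ ∘ suc) n)

*ˢ-negʳ : ∀ f g n → ((ℤ.-_ ∘ f) *ˢ g) n ≡ ℤ.- (f *ˢ g) n
*ˢ-negʳ f g zero    = lemma (f 0) (g 0)
  where
  lemma : ∀ x y → ℤ.- x ℤ.* y ℤ.+ 0ℤ ≡ ℤ.- (x ℤ.* y ℤ.+ 0ℤ)
  lemma = solve-∀
*ˢ-negʳ f g (suc n) = trans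
  (cong (ℤ._+_ (ℤ.- f 0 ℤ.* g (suc n))) (*ˢ-negʳ (f ∘ suc) g n))
  (lemma (f 0) (g (suc n)) _)
  where
  lemma : ∀ x y z → ℤ.- x ℤ.* y ℤ.+ ℤ.- z ≡ ℤ.- (x ℤ.* y ℤ.+ z)
  lemma = solve-∀

*ˢ-distribʳ--ˢ : ∀ f g h n → ((f -ˢ g) *ˢ h) n ≡ (f *ˢ h) n ℤ.- (g *ˢ h) n
*ˢ-distribʳ--ˢ f g h zero    = lemma (f 0) (g 0) (h 0)
  where
  lemma : ∀ x y z → (x ℤ.- y) ℤ.* z ℤ.+ 0ℤ ≡ (x ℤ.* z ℤ.+ 0ℤ) ℤ.- (y ℤ.* z ℤ.+ 0ℤ)
  lemma = solve-∀
*ˢ-distribʳ--ˢ f g h (suc n) = trans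
  (cong (ℤ._+_ ((f 0 ℤ.- g 0) ℤ.* h (suc n))) (*ˢ-distribʳ--ˢ (f ∘ suc) (g ∘ suc) h n))
  (lemma (f 0) (g 0) (h (suc n)) _ _)
  where
  lemma : ∀ x y z a b →
    (x ℤ.- y) ℤ.* z ℤ.+ (a ℤ.- b) ≡ (x ℤ.* z ℤ.+ a) ℤ.- (y ℤ.* z ℤ.+ b)
  lemma = solve-∀

X^-*ˢ : ∀ m f n → ((X^ m) *ˢ f) n ≡ shiftBy m f n
X^-*ˢ zero    f n = *ˢ-low 1ˢ f n (λ _ → refl)
X^-*ˢ (suc m) f zero    = refl
X^-*ˢ (suc m) f (suc n) = trans (ℤ.+-identityˡ _) (X^-*ˢ m f n)

partialProduct-suc : ∀ k n →
  partialProduct (suc k) n ≡ partialProduct k n ℤ.- shiftBy (2 ^ k) (partialProduct k) n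
partialProduct-suc k n = trans
  (*ˢ-distribʳ--ˢ 1ˢ (X^ (2 ^ k)) (partialProduct k) n)
  (cong₂ ℤ._-_ (X^-*ˢ 0 (partialProduct k) n) (X^-*ˢ (2 ^ k) (partialProduct k) n))

evens odds : Series → Series
evens f n = f (n * 2)
odds f n = f (1 + n * 2)

shiftBy-even : ∀ m f → evens (shiftBy (m * 2) f) ≗ shiftBy m (evens f)
shiftBy-even zero    f n       = refl
shiftBy-even (suc m) f zero    = refl
shiftBy-even (suc m) f (suc n) = shiftBy-even m f n

shiftBy-odd : ∀ m f → odds (shiftBy (m * 2) f) ≗ shiftBy m (odds f)
shiftBy-odd zero    f n       = refl
shiftBy-odd (suc m) f zero    = refl
shiftBy-odd (suc m) f (suc n) = shiftBy-odd m f n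

-- In closed form P_{k+1}(x) = (1 - x) P_k(x²). The recursion adds the top factor instead, so the
-- induction uses that a shift by 2^(k+1) = 2^k * 2 acts on each section as a shift by 2^k.
partialProduct-even : ∀ k → evens (partialProduct (suc k)) ≗ partialProduct k
partialProduct-odd  : ∀ k → odds (partialProduct (suc k)) ≗ ℤ.-_ ∘ partialProduct k

partialProduct-even zero    zero    = refl
partialProduct-even zero    (suc n) = partialProduct-suc 0 (suc n * 2)
partialProduct-even (suc k) n = begin
  partialProduct (2 + k) (n * 2)
    ≡⟨ partialProduct-suc (suc k) (n * 2) ⟩
  partialProduct (suc k) (n * 2) ℤ.- shiftBy (2 ^ suc k) (partialProduct (suc k)) (n * 2)
    ≡⟨ cong (λ m → partialProduct (suc k) (n * 2) ℤ.- shiftBy m (partialProduct (suc k)) (n * 2))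
         (ℕ.*-comm 2 (2 ^ k)) ⟩
  partialProduct (suc k) (n * 2) ℤ.- shiftBy (2 ^ k * 2) (partialProduct (suc k)) (n * 2)
    ≡⟨ cong₂ ℤ._-_ (partialProduct-even k n)
         (trans (shiftBy-even (2 ^ k) _ n) (shiftBy-cong (2 ^ k) (partialProduct-even k) n)) ⟩
  partialProduct k n ℤ.- shiftBy (2 ^ k) (partialProduct k) n
    ≡⟨ partialProduct-suc k n ⟨
  partialProduct (suc k) n ∎
  where open ≡-Reasoning

partialProduct-odd zero    zero    = refl
partialProduct-odd zero    (suc n) = partialProduct-suc 0 (1 + suc n * 2)
partialProduct-odd (suc k) n = begin
  partialProduct (2 + k) (1 + n * 2)
    ≡⟨ partialProduct-suc (suc k) (1 + n * 2) ⟩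
  partialProduct (suc k) (1 + n * 2) ℤ.- shiftBy (2 ^ suc k) (partialProduct (suc k)) (1 + n * 2)
    ≡⟨ cong (λ m → partialProduct (suc k) (1 + n * 2) ℤ.- shiftBy m (partialProduct (suc k)) (1 + n * 2))
         (ℕ.*-comm 2 (2 ^ k)) ⟩
  partialProduct (suc k) (1 + n * 2) ℤ.- shiftBy (2 ^ k * 2) (partialProduct (suc k)) (1 + n * 2)
    ≡⟨ cong₂ ℤ._-_ (partialProduct-odd k n)
         (trans (shiftBy-odd (2 ^ k) _ n)
           (trans (shiftBy-cong (2 ^ k) (partialProduct-odd k) n) (shiftBy-neg (2 ^ k) _ n))) ⟩
  ℤ.- partialProduct k n ℤ.- ℤ.- shiftBy (2 ^ k) (partialProduct k) n
    ≡⟨ ℤ.neg-distrib-+ (partialProduct k n) _ ⟨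
  ℤ.- (partialProduct k n ℤ.- shiftBy (2 ^ k) (partialProduct k) n)
    ≡⟨ cong ℤ.-_ (partialProduct-suc k n) ⟨
  ℤ.- partialProduct (suc k) n ∎
  where open ≡-Reasoning

T-stable : ∀ {n k} → n ≤ k → partialProduct k n ≡ T n
T-stable {n} {k} n≤k =
  subst (λ j → partialProduct j n ≡ T n) (ℕ.m∸n+n≡m n≤k) (T-limit n (k ℕ.∸ n))

T-even : evens T ≗ T
T-even n = begin
  -- One more factor does not change this coefficient and makes the index a successor; in `T-odd`
  -- the index is one already.
  T (n * 2)                          ≡⟨ T-limit (n * 2) 1 ⟨
  partialProduct (suc (n * 2)) (n * 2) ≡⟨ partialProduct-even (n * 2) n ⟩
  partialProduct (n * 2) n           ≡⟨ T-stable (ℕ.m≤m*n n 2) ⟩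
  T n                                ∎
  where open ≡-Reasoning

T-odd : odds T ≗ ℤ.-_ ∘ T
T-odd n = trans (partialProduct-odd (n * 2) n) (cong ℤ.-_ (T-stable (ℕ.m≤m*n n 2)))

-- Write f = f₀(x²) + x f₁(x²) and likewise g. The product of the two odd sections carries x², hence
-- the shift. The induction drops two coefficients of `f` at a time.
*ˢ-even : ∀ f g → evens (f *ˢ g) ≗ λ n → (evens f *ˢ evens g) n ℤ.+ shift (odds f *ˢ odds g) n
*ˢ-even f g zero    = sym (ℤ.+-identityʳ _)
*ˢ-even f g (suc n) = trans
  (cong (λ z → f 0 ℤ.* g (suc n * 2) ℤ.+ (f 1 ℤ.* g (1 + n * 2) ℤ.+ z))
    (*ˢ-even (λ i → f (2 + i)) g n))
  (trans (lemma (f 0 ℤ.* g (suc n * 2)) (f 1 ℤ.* g (1 + n * 2))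
      ((evens (λ i → f (2 + i)) *ˢ evens g) n) (shift (odds (λ i → f (2 + i)) *ˢ odds g) n))
    (cong (ℤ._+_ (f 0 ℤ.* g (suc n * 2) ℤ.+ (evens (λ i → f (2 + i)) *ˢ evens g) n))
      (sym (*ˢ-unfold (odds f) (odds g) n))))
  where
  lemma : ∀ a b c d → a ℤ.+ (b ℤ.+ (c ℤ.+ d)) ≡ a ℤ.+ c ℤ.+ (b ℤ.+ d)
  lemma = solve-∀

*ˢ-odd : ∀ f g → odds (f *ˢ g) ≗ λ n → (evens f *ˢ odds g) n ℤ.+ (odds f *ˢ evens g) n
*ˢ-odd f g zero    = lemma (f 0 ℤ.* g 1) (f 1 ℤ.* g 0)
  where
  lemma : ∀ a b → a ℤ.+ (b ℤ.+ 0ℤ) ≡ a ℤ.+ 0ℤ ℤ.+ (b ℤ.+ 0ℤ)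
  lemma = solve-∀
*ˢ-odd f g (suc n) = trans
  (cong (λ z → f 0 ℤ.* g (3 + n * 2) ℤ.+ (f 1 ℤ.* g (suc n * 2) ℤ.+ z))
    (*ˢ-odd (λ i → f (2 + i)) g n))
  (lemma (f 0 ℤ.* g (3 + n * 2)) (f 1 ℤ.* g (suc n * 2))
    ((evens (λ i → f (2 + i)) *ˢ odds g) n) ((odds (λ i → f (2 + i)) *ˢ evens g) n))
  where
  lemma : ∀ a b c d → a ℤ.+ (b ℤ.+ (c ℤ.+ d)) ≡ a ℤ.+ c ℤ.+ (b ℤ.+ d)
  lemma = solve-∀

-- act p f is the product of f by the polynomial with coefficient list p.
act : List ℤ → Series → Series
act []      f n = 0ℤ
act (c ∷ p) f n = c ℤ.* f n ℤ.+ shift (act p f) n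

*ˢ-act : ∀ f p g → f *ˢ act p g ≗ act p (f *ˢ g)
*ˢ-act f [] g n = zeroʳ f n
  where
  zeroʳ : ∀ f n → (f *ˢ λ _ → 0ℤ) n ≡ 0ℤ
  zeroʳ f zero    = trans (ℤ.+-identityʳ _) (ℤ.*-zeroʳ (f 0))
  zeroʳ f (suc n) = cong₂ ℤ._+_ (ℤ.*-zeroʳ (f 0)) (zeroʳ (f ∘ suc) n)
*ˢ-act f (c ∷ p) g n = trans (linear f n)
  (cong (ℤ._+_ (c ℤ.* (f *ˢ g) n))
    (trans (shiftʳ f (act p g) n) (shift-cong (*ˢ-act f p g) n)))
  where
  linear : ∀ f n → (f *ˢ λ i → c ℤ.* g i ℤ.+ shift (act p g) i) n ≡
           c ℤ.* (f *ˢ g) n ℤ.+ (f *ˢ shift (act p g)) n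
  linear f zero    = lemma c (f 0) (g 0)
    where
    lemma : ∀ c x y → x ℤ.* (c ℤ.* y ℤ.+ 0ℤ) ℤ.+ 0ℤ ≡
            c ℤ.* (x ℤ.* y ℤ.+ 0ℤ) ℤ.+ (x ℤ.* 0ℤ ℤ.+ 0ℤ)
    lemma = solve-∀
  linear f (suc n) = trans
    (cong (ℤ._+_ (f 0 ℤ.* (c ℤ.* g (suc n) ℤ.+ act p g n))) (linear (f ∘ suc) n))
    (lemma c (f 0) (g (suc n)) _ _ _)
    where
    lemma : ∀ c x y z a b → x ℤ.* (c ℤ.* y ℤ.+ z) ℤ.+ (c ℤ.* a ℤ.+ b) ≡
            c ℤ.* (x ℤ.* y ℤ.+ a) ℤ.+ (x ℤ.* z ℤ.+ b)
    lemma = solve-∀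
  shiftʳ : ∀ f g → f *ˢ shift g ≗ shift (f *ˢ g)
  shiftʳ f g zero    = trans (ℤ.+-identityʳ _) (ℤ.*-zeroʳ (f 0))
  shiftʳ f g (suc n) = trans
    (cong (ℤ._+_ (f 0 ℤ.* g n)) (shiftʳ (f ∘ suc) g n)) (sym (*ˢ-unfold f g n))

infixl 6 _⊖_
_⊖_ : List ℤ → List ℤ → List ℤ
p       ⊖ []      = p
[]      ⊖ (d ∷ q) = ℤ.- d ∷ ([] ⊖ q)
(c ∷ p) ⊖ (d ∷ q) = (c ℤ.- d) ∷ (p ⊖ q)

act-⊖ : ∀ p q f n → act (p ⊖ q) f n ≡ act p f n ℤ.- act q f n
act-⊖ []      []      f n = refl
act-⊖ (c ∷ p) []      f n = sym (ℤ.+-identityʳ _)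
act-⊖ []      (d ∷ q) f n = trans
  (cong (ℤ._+_ (ℤ.- d ℤ.* f n)) (shift-⊖ n)) (lemma d (f n) _)
  where
  shift-⊖ : ∀ n → shift (act ([] ⊖ q) f) n ≡ ℤ.- shift (act q f) n
  shift-⊖ zero    = refl
  shift-⊖ (suc n) = trans (act-⊖ [] q f n) (ℤ.+-identityˡ _)
  lemma : ∀ d x y → ℤ.- d ℤ.* x ℤ.+ ℤ.- y ≡ 0ℤ ℤ.- (d ℤ.* x ℤ.+ y)
  lemma = solve-∀
act-⊖ (c ∷ p) (d ∷ q) f n = trans
  (cong (ℤ._+_ ((c ℤ.- d) ℤ.* f n)) (shift-⊖ n)) (lemma c d (f n) _ _)
  where
  shift-⊖ : ∀ n → shift (act (p ⊖ q) f) n ≡ shift (act p f) n ℤ.- shift (act q f) n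
  shift-⊖ zero    = refl
  shift-⊖ (suc n) = act-⊖ p q f n
  lemma : ∀ c d x y z →
    (c ℤ.- d) ℤ.* x ℤ.+ (y ℤ.- z) ≡ (c ℤ.* x ℤ.+ y) ℤ.- (d ℤ.* x ℤ.+ z)
  lemma = solve-∀

-- (1 - x)^k = p(x²) + x q(x²) for p = evenPart k and q = oddPart k.
evenPart oddPart : ℕ → List ℤ
evenPart zero    = 1ℤ ∷ []
evenPart (suc k) = evenPart k ⊖ (0ℤ ∷ oddPart k)
oddPart zero     = []
oddPart (suc k)  = oddPart k ⊖ evenPart k

T-even*ˢ : ∀ p {f} g → f ≗ act p g → evens T *ˢ f ≗ act p (T *ˢ g)
T-even*ˢ p {f} g f≗pg n = begin
  (evens T *ˢ f) n      ≡⟨ *ˢ-congʳ f T-even n ⟩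
  (T *ˢ f) n           ≡⟨ *ˢ-congˡ T f≗pg n ⟩
  (T *ˢ act p g) n     ≡⟨ *ˢ-act T p g n ⟩
  act p (T *ˢ g) n     ∎
  where open ≡-Reasoning

T-odd*ˢ : ∀ p {f} g → f ≗ act p g → odds T *ˢ f ≗ ℤ.-_ ∘ act p (T *ˢ g)
T-odd*ˢ p {f} g f≗pg n = begin
  (odds T *ˢ f) n          ≡⟨ *ˢ-congʳ f T-odd n ⟩
  ((ℤ.-_ ∘ T) *ˢ f) n      ≡⟨ *ˢ-negʳ T f n ⟩
  ℤ.- (T *ˢ f) n           ≡⟨ cong ℤ.-_ (*ˢ-congˡ T f≗pg n) ⟩
  ℤ.- (T *ˢ act p g) n     ≡⟨ cong ℤ.-_ (*ˢ-act T p g n) ⟩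
  ℤ.- act p (T *ˢ g) n     ∎
  where open ≡-Reasoning

-- These are the two sections of T(x)^k = (1 - x)^k T(x²)^k. Each further factor T contributes the
-- sections T and -T, in step with the recursion of `evenPart` and `oddPart`.
T^-even : ∀ k → evens (T ^ˢ k) ≗ act (evenPart k) (T ^ˢ k)
T^-odd  : ∀ k → odds (T ^ˢ k) ≗ act (oddPart k) (T ^ˢ k)

T^-even zero    zero    = refl
T^-even zero    (suc n) = refl
T^-even (suc k) n = begin
  evens (T *ˢ g) n
    ≡⟨ *ˢ-even T g n ⟩
  (evens T *ˢ evens g) n ℤ.+ shift (odds T *ˢ odds g) n
    ≡⟨ cong₂ ℤ._+_ (T-even*ˢ p g (T^-even k) n) (shift-cong (T-odd*ˢ q g (T^-odd k)) n) ⟩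
  act p (T *ˢ g) n ℤ.+ shift (ℤ.-_ ∘ act q (T *ˢ g)) n
    -- The shift is multiplication by x, that is, a zero in front of the coefficient list `q`.
    ≡⟨ cong (ℤ._+_ (act p (T *ˢ g) n)) (trans (shiftBy-neg 1 (act q (T *ˢ g)) n)
         (cong ℤ.-_ (sym (ℤ.+-identityˡ (shift (act q (T *ˢ g)) n))))) ⟩
  act p (T *ˢ g) n ℤ.- act (0ℤ ∷ q) (T *ˢ g) n
    ≡⟨ act-⊖ p (0ℤ ∷ q) (T *ˢ g) n ⟨
  act (p ⊖ (0ℤ ∷ q)) (T *ˢ g) n ∎
  where
  open ≡-Reasoning
  p q : List ℤ
  p = evenPart k
  q = oddPart k
  g : Series
  g = T ^ˢ k

T^-odd zero    n = refl
T^-odd (suc k) n = begin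
  odds (T *ˢ g) n
    ≡⟨ *ˢ-odd T g n ⟩
  (evens T *ˢ odds g) n ℤ.+ (odds T *ˢ evens g) n
    ≡⟨ cong₂ ℤ._+_ (T-even*ˢ q g (T^-odd k) n) (T-odd*ˢ p g (T^-even k) n) ⟩
  act q (T *ˢ g) n ℤ.- act p (T *ˢ g) n
    ≡⟨ act-⊖ q p (T *ˢ g) n ⟨
  act (q ⊖ p) (T *ˢ g) n ∎
  where
  open ≡-Reasoning
  p q : List ℤ
  p = evenPart k
  q = oddPart k
  g : Series
  g = T ^ˢ k

-- Recurrences for the coefficients of x⁵T⁶

shift-0 : ∀ n → shift (λ _ → 0ℤ) n ≡ 0ℤ
shift-0 zero    = refl
shift-0 (suc n) = refl

-- Since 5 is odd, the shift exchanges the sections: even places obey the coefficients of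
-- `oddPart 6`. For `n` < 5 some terms would have a negative index in `f`; the zeros brought in by
-- the shift stand for them.
shiftBy5-even : ∀ f → odds f ≗ act (-[1+ 5 ] ∷ -[1+ 19 ] ∷ -[1+ 5 ] ∷ []) f →
  ∀ n → shiftBy 5 f (n * 2) ≡
  -[1+ 5 ] ℤ.* shiftBy 5 f (2 + n) ℤ.+
  (-[1+ 19 ] ℤ.* shiftBy 5 f (1 + n) ℤ.+ (-[1+ 5 ] ℤ.* shiftBy 5 f n ℤ.+ 0ℤ))
shiftBy5-even f odd≗ 0 = refl
shiftBy5-even f odd≗ 1 = refl
shiftBy5-even f odd≗ 2 = refl
shiftBy5-even f odd≗ 3 = odd≗ 0
shiftBy5-even f odd≗ 4 = odd≗ 1
shiftBy5-even f odd≗ (suc (suc (suc (suc (suc n))))) = trans (odd≗ (2 + n))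
  (cong (λ z → -[1+ 5 ] ℤ.* f (2 + n) ℤ.+ (-[1+ 19 ] ℤ.* f (1 + n) ℤ.+ (-[1+ 5 ] ℤ.* f n ℤ.+ z)))
    (shift-0 n))

shiftBy5-odd : ∀ f → evens f ≗ act (+ 1 ∷ + 15 ∷ + 15 ∷ + 1 ∷ []) f →
  ∀ n → shiftBy 5 f (1 + n * 2) ≡
  + 1 ℤ.* shiftBy 5 f (3 + n) ℤ.+ (+ 15 ℤ.* shiftBy 5 f (2 + n) ℤ.+
  (+ 15 ℤ.* shiftBy 5 f (1 + n) ℤ.+ (+ 1 ℤ.* shiftBy 5 f n ℤ.+ 0ℤ)))
shiftBy5-odd f even≗ 0 = refl
shiftBy5-odd f even≗ 1 = refl
shiftBy5-odd f even≗ 2 = even≗ 0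
shiftBy5-odd f even≗ 3 = even≗ 1
shiftBy5-odd f even≗ 4 = even≗ 2
shiftBy5-odd f even≗ (suc (suc (suc (suc (suc n))))) = trans (even≗ (3 + n))
  (cong (λ z → + 1 ℤ.* f (3 + n) ℤ.+ (+ 15 ℤ.* f (2 + n) ℤ.+
    (+ 15 ℤ.* f (1 + n) ℤ.+ (+ 1 ℤ.* f n ℤ.+ z)))) (shift-0 n))

abstract
  -- The coefficients of x⁵T⁶, whose recurrences hold without boundary terms.
  β : Series
  β = shiftBy 5 t₆

  β-5+ : ∀ n → β (5 + n) ≡ t₆ n
  β-5+ n = refl

  β-0 : ∀ {n} → n ℕ.< 5 → β n ≡ 0ℤ
  β-0 {0} _ = refl
  β-0 {1} _ = refl
  β-0 {2} _ = refl
  β-0 {3} _ = refl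
  β-0 {4} _ = refl
  β-0 {suc (suc (suc (suc (suc n))))} (s≤s (s≤s (s≤s (s≤s (s≤s ())))))

  β-even : ∀ n → β (n * 2) ≡
    -[1+ 5 ] ℤ.* β (2 + n) ℤ.+ (-[1+ 19 ] ℤ.* β (1 + n) ℤ.+ (-[1+ 5 ] ℤ.* β n ℤ.+ 0ℤ))
  β-even = shiftBy5-even t₆ (T^-odd 6)

  β-odd : ∀ n → β (1 + n * 2) ≡ + 1 ℤ.* β (3 + n) ℤ.+
    (+ 15 ℤ.* β (2 + n) ℤ.+ (+ 15 ℤ.* β (1 + n) ℤ.+ (+ 1 ℤ.* β n ℤ.+ 0ℤ)))
  β-odd = shiftBy5-odd t₆ (T^-even 6)

-- Integer vectors and matrices

infix  8 _⊡_
infixr 7 _·_ _•_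
infixl 6 _⊞_

_⊡_ : ∀ {n} → Vec ℤ n → Vec ℤ n → ℤ
[]      ⊡ []      = 0ℤ
(a ∷ r) ⊡ (x ∷ v) = a ℤ.* x ℤ.+ r ⊡ v

_⊞_ : ∀ {n} → Vec ℤ n → Vec ℤ n → Vec ℤ n
_⊞_ = zipWith ℤ._+_

_•_ : ∀ {n} → ℤ → Vec ℤ n → Vec ℤ n
a • v = map (a ℤ.*_) v

Matrix : ℕ → ℕ → Set
Matrix m n = Vec (Vec ℤ n) m

_·_ : ∀ {m n} → Matrix m n → Vec ℤ n → Vec ℤ m
M · v = map (_⊡ v) M

_⊗_ : ∀ {m n} → Vec ℤ m → Matrix m n → Vec ℤ n
[]      ⊗ []      = replicate _ 0ℤ
(a ∷ r) ⊗ (s ∷ M) = a • s ⊞ r ⊗ M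

_⊠_ : ∀ {l m n} → Matrix l m → Matrix m n → Matrix l n
M ⊠ N = map (_⊗ N) M

0⊡ : ∀ {n} (v : Vec ℤ n) → replicate n 0ℤ ⊡ v ≡ 0ℤ
0⊡ []      = refl
0⊡ (x ∷ v) = trans (ℤ.+-identityˡ _) (0⊡ v)

⊞-⊡ : ∀ {n} (r s v : Vec ℤ n) → (r ⊞ s) ⊡ v ≡ r ⊡ v ℤ.+ s ⊡ v
⊞-⊡ []      []      []      = refl
⊞-⊡ (a ∷ r) (b ∷ s) (x ∷ v) = trans
  (cong (ℤ._+_ ((a ℤ.+ b) ℤ.* x)) (⊞-⊡ r s v)) (rearrange a b x (r ⊡ v) (s ⊡ v))
  where
  rearrange : ∀ a b x y z →
    (a ℤ.+ b) ℤ.* x ℤ.+ (y ℤ.+ z) ≡ (a ℤ.* x ℤ.+ y) ℤ.+ (b ℤ.* x ℤ.+ z)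
  rearrange = solve-∀

•-⊡ : ∀ {n} a (r v : Vec ℤ n) → (a • r) ⊡ v ≡ a ℤ.* r ⊡ v
•-⊡ a []      []      = sym (ℤ.*-zeroʳ a)
•-⊡ a (b ∷ r) (x ∷ v) = trans
  (cong (ℤ._+_ (a ℤ.* b ℤ.* x)) (•-⊡ a r v)) (rearrange a b x (r ⊡ v))
  where
  rearrange : ∀ a b x y → a ℤ.* b ℤ.* x ℤ.+ a ℤ.* y ≡ a ℤ.* (b ℤ.* x ℤ.+ y)
  rearrange = solve-∀

⊡-• : ∀ {n} a (r v : Vec ℤ n) → r ⊡ (a • v) ≡ a ℤ.* r ⊡ v
⊡-• a []      []      = sym (ℤ.*-zeroʳ a)
⊡-• a (b ∷ r) (x ∷ v) = trans
  (cong (ℤ._+_ (b ℤ.* (a ℤ.* x))) (⊡-• a r v)) (rearrange a b x (r ⊡ v))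
  where
  rearrange : ∀ a b x y → b ℤ.* (a ℤ.* x) ℤ.+ a ℤ.* y ≡ a ℤ.* (b ℤ.* x ℤ.+ y)
  rearrange = solve-∀

⊡-· : ∀ {m n} (r : Vec ℤ m) (M : Matrix m n) v → r ⊡ (M · v) ≡ (r ⊗ M) ⊡ v
⊡-· []      []      v = sym (0⊡ v)
⊡-· (a ∷ r) (s ∷ M) v = begin
  a ℤ.* s ⊡ v ℤ.+ r ⊡ (M · v)        ≡⟨ cong₂ ℤ._+_ (sym (•-⊡ a s v)) (⊡-· r M v) ⟩
  (a • s) ⊡ v ℤ.+ (r ⊗ M) ⊡ v        ≡⟨ ⊞-⊡ (a • s) (r ⊗ M) v ⟨
  (a • s ⊞ r ⊗ M) ⊡ v                ∎
  where open ≡-Reasoning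

·-⊠ : ∀ {l m n} (M : Matrix l m) (N : Matrix m n) v → M · (N · v) ≡ (M ⊠ N) · v
·-⊠ []      N v = refl
·-⊠ (r ∷ M) N v = cong₂ _∷_ (⊡-· r N v) (·-⊠ M N v)

·-• : ∀ {m n} a (M : Matrix m n) v → M · (a • v) ≡ a • (M · v)
·-• a []      v = refl
·-• a (r ∷ M) v = cong₂ _∷_ (⊡-• a r v) (·-• a M v)

•-· : ∀ {m n} a (M : Matrix m n) v → map (a •_) M · v ≡ a • (M · v)
•-· a []      v = refl
•-· a (r ∷ M) v = cong₂ _∷_ (•-⊡ a r v) (•-· a M v)

-- Windows of `β` and the matrices of the binary digits

window : ∀ m → ℕ → Vec ℤ m
window zero    n = []
window (suc m) n = β n ∷ window m (suc n)

pad : ∀ i {m} → Vec ℤ m → ∀ j → Vec ℤ (i + (m + j))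
pad i r j = replicate i 0ℤ ++ (r ++ replicate j 0ℤ)

pad-⊡ : ∀ i {m} (r : Vec ℤ m) j n → pad i r j ⊡ window _ n ≡ r ⊡ window m (i + n)
pad-⊡ zero []      j n = 0⊡ (window j n)
pad-⊡ zero (a ∷ r) j n = cong (ℤ._+_ (a ℤ.* β n)) (pad-⊡ zero r j (suc n))
pad-⊡ (suc i) r j n = trans (ℤ.+-identityˡ _)
  (trans (pad-⊡ i r j (suc n)) (cong (λ k → r ⊡ window _ k) (ℕ.+-suc i n)))

evenRow : Vec ℤ 3
evenRow = -[1+ 5 ] ∷ -[1+ 19 ] ∷ -[1+ 5 ] ∷ []

oddRow : Vec ℤ 4
oddRow = + 1 ∷ + 15 ∷ + 15 ∷ + 1 ∷ []

-- The recurrence runs from the highest index down, a window from the lowest up. The coefficients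
-- form a palindrome, so only the order of the summands changes.
β-evenRow : ∀ n → β (n * 2) ≡ evenRow ⊡ window 3 n
β-evenRow n = trans (β-even n) (reverse (β n) (β (1 + n)) (β (2 + n)))
  where
  reverse : ∀ x y z →
    -[1+ 5 ] ℤ.* z ℤ.+ (-[1+ 19 ] ℤ.* y ℤ.+ (-[1+ 5 ] ℤ.* x ℤ.+ 0ℤ)) ≡
    -[1+ 5 ] ℤ.* x ℤ.+ (-[1+ 19 ] ℤ.* y ℤ.+ (-[1+ 5 ] ℤ.* z ℤ.+ 0ℤ))
  reverse = solve-∀

β-oddRow : ∀ n → β (1 + n * 2) ≡ oddRow ⊡ window 4 n
β-oddRow n = trans (β-odd n) (reverse (β n) (β (1 + n)) (β (2 + n)) (β (3 + n)))
  where
  reverse : ∀ x y z w →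
    + 1 ℤ.* w ℤ.+ (+ 15 ℤ.* z ℤ.+ (+ 15 ℤ.* y ℤ.+ (+ 1 ℤ.* x ℤ.+ 0ℤ))) ≡
    + 1 ℤ.* x ℤ.+ (+ 15 ℤ.* y ℤ.+ (+ 15 ℤ.* z ℤ.+ (+ 1 ℤ.* w ℤ.+ 0ℤ)))
  reverse = solve-∀

β-even-pad : ∀ i j n → β ((i + n) * 2) ≡ pad i evenRow j ⊡ window _ n
β-even-pad i j n = trans (β-evenRow (i + n)) (sym (pad-⊡ i evenRow j n))

β-odd-pad : ∀ i j n → β (1 + (i + n) * 2) ≡ pad i oddRow j ⊡ window _ n
β-odd-pad i j n = trans (β-oddRow (i + n)) (sym (pad-⊡ i oddRow j n))

-- Width 6 is closed under both digits: the entries at 2n, ..., 2n + 6 read `β` only at n, ..., n +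
-- 5. Width 5 is closed under doubling, which gives `B`, but the entry at 2n + 5 reads `β` at n + 5.
A₀ A₁ : Matrix 6 6
A₀ = pad 0 evenRow 3 ∷ pad 0 oddRow 2 ∷ pad 1 evenRow 2 ∷ pad 1 oddRow 1 ∷
     pad 2 evenRow 1 ∷ pad 2 oddRow 0 ∷ []
A₁ = pad 0 oddRow 2 ∷ pad 1 evenRow 2 ∷ pad 1 oddRow 1 ∷ pad 2 evenRow 1 ∷
     pad 2 oddRow 0 ∷ pad 3 evenRow 0 ∷ []

B : Matrix 5 5
B = pad 0 evenRow 2 ∷ pad 0 oddRow 1 ∷ pad 1 evenRow 1 ∷ pad 1 oddRow 0 ∷
    pad 2 evenRow 0 ∷ []

window-A₀ : ∀ n → window 6 (n * 2) ≡ A₀ · window 6 n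
window-A₀ n = cong₂ _∷_ (β-even-pad 0 3 n) (cong₂ _∷_ (β-odd-pad 0 2 n)
  (cong₂ _∷_ (β-even-pad 1 2 n) (cong₂ _∷_ (β-odd-pad 1 1 n)
  (cong₂ _∷_ (β-even-pad 2 1 n) (cong₂ _∷_ (β-odd-pad 2 0 n) refl)))))

window-A₁ : ∀ n → window 6 (1 + n * 2) ≡ A₁ · window 6 n
window-A₁ n = cong₂ _∷_ (β-odd-pad 0 2 n) (cong₂ _∷_ (β-even-pad 1 2 n)
  (cong₂ _∷_ (β-odd-pad 1 1 n) (cong₂ _∷_ (β-even-pad 2 1 n)
  (cong₂ _∷_ (β-odd-pad 2 0 n) (cong₂ _∷_ (β-even-pad 3 0 n) refl)))))

window-B : ∀ n → window 5 (n * 2) ≡ B · window 5 n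
window-B n = cong₂ _∷_ (β-even-pad 0 2 n) (cong₂ _∷_ (β-odd-pad 0 1 n)
  (cong₂ _∷_ (β-even-pad 1 1 n) (cong₂ _∷_ (β-odd-pad 1 0 n)
  (cong₂ _∷_ (β-even-pad 2 0 n) refl))))

-- The vectors x and u

Odd : ℤ → Set
Odd z = ∃ λ h → z ≡ 1ℤ ℤ.+ + 2 ℤ.* h

Odd-+2* : ∀ {a} → Odd a → ∀ b → Odd (a ℤ.+ + 2 ℤ.* b)
Odd-+2* (h , refl) b = h ℤ.+ b , collect h b
  where
  collect : ∀ h b → 1ℤ ℤ.+ + 2 ℤ.* h ℤ.+ + 2 ℤ.* b ≡ 1ℤ ℤ.+ + 2 ℤ.* (h ℤ.+ b)
  collect = solve-∀

halfDiff : ∀ {n} → Vec ℤ n → Vec ℤ n → Vec ℤ n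
halfDiff = zipWith λ a b → (a ℤ.- b) /ℕ 2

-- The equation on `r` says that `r` and `s` agree modulo 2 entry by entry. For closed rows it is
-- verified by computing `halfDiff`, so `refl` proves it.
Odd-⊡ : ∀ {n} (r s v : Vec ℤ n) → r ≡ s ⊞ + 2 • halfDiff r s → Odd (s ⊡ v) → Odd (r ⊡ v)
Odd-⊡ r s v r≡ odd-s = subst Odd
  (begin
    s ⊡ v ℤ.+ + 2 ℤ.* halfDiff r s ⊡ v     ≡⟨ cong (ℤ._+_ (s ⊡ v)) (•-⊡ (+ 2) (halfDiff r s) v) ⟨
    s ⊡ v ℤ.+ (+ 2 • halfDiff r s) ⊡ v     ≡⟨ ⊞-⊡ s (+ 2 • halfDiff r s) v ⟨
    (s ⊞ + 2 • halfDiff r s) ⊡ v           ≡⟨ cong (_⊡ v) r≡ ⟨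
    r ⊡ v                                  ∎)
  (Odd-+2* odd-s (halfDiff r s ⊡ v))
  where open ≡-Reasoning

-- The columns form the triangular (Hermite) basis of the lattice.
D : Matrix 5 5
D = (+ 16   ∷ + 0     ∷ + 0     ∷ + 0    ∷ + 0     ∷ [])
  ∷ (+ 14   ∷ + 16    ∷ + 0     ∷ + 0    ∷ + 0     ∷ [])
  ∷ (+ 348  ∷ + 160   ∷ + 512   ∷ + 0    ∷ + 0     ∷ [])
  ∷ (+ 270  ∷ + 144   ∷ + 512   ∷ + 1024 ∷ + 0     ∷ [])
  ∷ (+ 2576 ∷ + 32512 ∷ + 28672 ∷ + 2048 ∷ + 32768 ∷ [])
  ∷ []

-- R = D⁻¹ (B / 2) D.
R : Matrix 5 5
R = (ℤ.- + 77  ∷ ℤ.- + 40  ∷ ℤ.- + 96  ∷ + 0       ∷ + 0     ∷ [])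
  ∷ (+ 246     ∷ + 122     ∷ + 340     ∷ + 32      ∷ + 0     ∷ [])
  ∷ (ℤ.- + 33  ∷ ℤ.- + 15  ∷ ℤ.- + 54  ∷ ℤ.- + 16  ∷ + 0     ∷ [])
  ∷ (+ 8       ∷ + 19      ∷ + 26      ∷ + 12      ∷ + 16    ∷ [])
  ∷ (ℤ.- + 210 ∷ ℤ.- + 109 ∷ ℤ.- + 287 ∷ ℤ.- + 19  ∷ ℤ.- + 4 ∷ [])
  ∷ []

-- L = D⁻¹ B³ A₁′, where A₁′ consists of the first five rows of A₁.
L : Matrix 5 6
L = (ℤ.- + 15 ∷ + 429     ∷ + 2226     ∷ + 210     ∷ ℤ.- + 291 ∷ + 1     ∷ [])
  ∷ (+ 17     ∷ ℤ.- + 897 ∷ ℤ.- + 2142 ∷ + 1526    ∷ + 477     ∷ ℤ.- + 5 ∷ [])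
  ∷ (+ 5      ∷ ℤ.- + 7   ∷ ℤ.- + 906  ∷ ℤ.- + 682 ∷ + 53      ∷ + 1     ∷ [])
  ∷ (ℤ.- + 1  ∷ + 20      ∷ + 194      ∷ + 68      ∷ ℤ.- + 25  ∷ + 0     ∷ [])
  ∷ (ℤ.- + 20 ∷ + 861     ∷ + 2731     ∷ ℤ.- + 937 ∷ ℤ.- + 495 ∷ + 4     ∷ [])
  ∷ []

window-odd : ∀ k → window 5 (1 + k * 2) ≡ take 5 A₁ · window 6 k
window-odd k = cong (take 5) (window-A₁ k)

window-4odd : ∀ k → window 5 ((1 + k * 2) * 2 * 2) ≡ (B ⊠ (B ⊠ take 5 A₁)) · window 6 k
window-4odd k = begin
  window 5 ((1 + k * 2) * 2 * 2)          ≡⟨ window-B ((1 + k * 2) * 2) ⟩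
  B · window 5 ((1 + k * 2) * 2)          ≡⟨ cong (B ·_) (window-B (1 + k * 2)) ⟩
  B · (B · window 5 (1 + k * 2))          ≡⟨ cong (λ v → B · (B · v)) (window-odd k) ⟩
  B · (B · (take 5 A₁ · window 6 k))      ≡⟨ cong (B ·_) (·-⊠ B (take 5 A₁) (window 6 k)) ⟩
  B · ((B ⊠ take 5 A₁) · window 6 k)      ≡⟨ ·-⊠ B (B ⊠ take 5 A₁) (window 6 k) ⟩
  (B ⊠ (B ⊠ take 5 A₁)) · window 6 k      ∎
  where open ≡-Reasoning

window-8odd : ∀ k → window 5 ((1 + k * 2) * 2 * 2 * 2) ≡ D · (L · window 6 k)
window-8odd k = begin
  window 5 ((1 + k * 2) * 2 * 2 * 2)              ≡⟨ window-B ((1 + k * 2) * 2 * 2) ⟩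
  B · window 5 ((1 + k * 2) * 2 * 2)              ≡⟨ cong (B ·_) (window-4odd k) ⟩
  B · ((B ⊠ (B ⊠ take 5 A₁)) · window 6 k)        ≡⟨ ·-⊠ B (B ⊠ (B ⊠ take 5 A₁)) (window 6 k) ⟩
  -- The columns of B³ A₁′ lie in the lattice of `D`, with coordinates `L`; both products are closed
  -- and evaluate to the same matrix.
  (B ⊠ (B ⊠ (B ⊠ take 5 A₁))) · window 6 k        ≡⟨⟩
  (D ⊠ L) · window 6 k                            ≡⟨ ·-⊠ D L (window 6 k) ⟨
  D · (L · window 6 k)                            ∎
  where open ≡-Reasoning

-- This is the invariance of the lattice under B / 2, by evaluation of B D = 2 D R: each doubling of
-- the index releases exactly one factor 2 and acts on the coordinates by `R`.
B·D : ∀ u → B · (D · u) ≡ + 2 • (D · (R · u))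
B·D u = begin
  B · (D · u)                   ≡⟨ ·-⊠ B D u ⟩
  (B ⊠ D) · u                   ≡⟨⟩
  map (+ 2 •_) (D ⊠ R) · u      ≡⟨ •-· (+ 2) (D ⊠ R) u ⟩
  + 2 • ((D ⊠ R) · u)           ≡⟨ cong (+ 2 •_) (·-⊠ D R u) ⟨
  + 2 • (D · (R · u))           ∎
  where open ≡-Reasoning

-- ξ ⊡ x and υ ⊡ u stay odd; modulo 2, every form used below is one of these.
ξ : Vec ℤ 6
ξ = + 1 ∷ + 1 ∷ + 0 ∷ + 0 ∷ + 1 ∷ + 1 ∷ []

υ : Vec ℤ 5
υ = + 1 ∷ + 0 ∷ + 0 ∷ + 0 ∷ + 0 ∷ []

State : Set
State = Vec ℤ 6 × Vec ℤ 5

-- The state after the digits of `k`. Here `e` is the number of trailing ones of `k`. The vector `u`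
-- concerns the window at 8(k + 1), since the places 8k + 3, ..., 8k + 7 of `t₆` are the places 8(k
-- + 1), ..., 8(k + 1) + 4 of `β`.
record Tracks (k : ℕ) (s : State) : Set where
  constructor tracks
  x : Vec ℤ 6
  x = proj₁ s
  u : Vec ℤ 5
  u = proj₂ s
  field
    window≡     : window 6 k ≡ x
    e j         : ℕ
    factor      : suc k ≡ 2 ^ e * (1 + j * 2)
    lattice     : window 5 (suc k * 2 * 2 * 2) ≡ + (2 ^ e) • (D · u)
    odd-x       : Odd (ξ ⊡ x)
    odd-u       : Odd (υ ⊡ u)

-- Digit 0 turns k + 1 into the odd number 2k + 1, so `u` restarts from `x` through `L`. Digit 1
-- turns k + 1 into 2(k + 1), so `u` advances by `R`.
step : State → Bit → State
step (x , u) zero       = A₀ · x , L · x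
step (x , u) (suc zero) = A₁ · x , R · u

s₀ : State
s₀ = x₀ , L · x₀
  where
  -- The window at 0: its only nonzero entry is `β 5` = `t₆ 0` = 1.
  x₀ = + 0 ∷ + 0 ∷ + 0 ∷ + 0 ∷ + 0 ∷ + 1 ∷ []

1• : ∀ {n} (v : Vec ℤ n) → 1ℤ • v ≡ v
1• v = trans (Vec.map-cong ℤ.*-identityˡ v) (Vec.map-id v)

•-• : ∀ {n} a b (v : Vec ℤ n) → a • (b • v) ≡ (a ℤ.* b) • v
•-• a b v = trans (sym (Vec.map-∘ _ _ v)) (Vec.map-cong (λ x → sym (ℤ.*-assoc a b x)) v)

-- Parity passes through a matrix by a congruence of row vectors. It is applied to ξ A₀ ≡ ξ, ξ A₁ ≡
-- ξ, υ L ≡ ξ and υ R ≡ υ modulo 2.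
Odd-⊡-· : ∀ {m n} (r : Vec ℤ m) (M : Matrix m n) (s v : Vec ℤ n) →
  r ⊗ M ≡ s ⊞ + 2 • halfDiff (r ⊗ M) s → Odd (s ⊡ v) → Odd (r ⊡ (M · v))
Odd-⊡-· r M s v r≡ odd-s = subst Odd (sym (⊡-· r M v)) (Odd-⊡ (r ⊗ M) s v r≡ odd-s)

tracks-step : ∀ {k s} → Tracks k s → ∀ b → Tracks (toℕ b + k * 2) (step s b)
tracks-step {k} {x , u} (tracks refl e j factor lattice odd-x odd-u) zero = record
  { window≡ = window-A₀ k
  ; e = 0
  ; j = k
  ; factor = sym (ℕ.+-identityʳ (1 + k * 2))
  ; lattice = trans (window-8odd k) (sym (1• _))
  ; odd-x = Odd-⊡-· ξ A₀ ξ x refl odd-x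
  ; odd-u = Odd-⊡-· υ L ξ x refl odd-x
  }
tracks-step {k} {x , u} (tracks refl e j factor lattice odd-x odd-u) (suc zero) = record
  { window≡ = window-A₁ k
  ; e = suc e
  ; j = j
  ; factor = trans (cong (_* 2) factor)
      (trans (ℕ.*-comm (2 ^ e * (1 + j * 2)) 2) (sym (ℕ.*-assoc 2 (2 ^ e) (1 + j * 2))))
  ; lattice = begin
      window 5 (suc k * 2 * 2 * 2 * 2)             ≡⟨ window-B (suc k * 2 * 2 * 2) ⟩
      B · window 5 (suc k * 2 * 2 * 2)             ≡⟨ cong (B ·_) lattice ⟩
      B · (+ (2 ^ e) • (D · u))                    ≡⟨ ·-• (+ (2 ^ e)) B (D · u) ⟩
      + (2 ^ e) • (B · (D · u))                    ≡⟨ cong (+ (2 ^ e) •_) (B·D u) ⟩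
      + (2 ^ e) • (+ 2 • (D · (R · u)))            ≡⟨ •-• (+ (2 ^ e)) (+ 2) (D · (R · u)) ⟩
      (+ (2 ^ e) ℤ.* + 2) • (D · (R · u))          ≡⟨ cong (_• (D · (R · u))) 2^e*2 ⟩
      + (2 ^ suc e) • (D · (R · u))                ∎
  ; odd-x = Odd-⊡-· ξ A₁ ξ x refl odd-x
  ; odd-u = Odd-⊡-· υ R υ u refl odd-u
  }
  where
  open ≡-Reasoning
  2^e*2 : + (2 ^ e) ℤ.* + 2 ≡ + (2 ^ suc e)
  2^e*2 = trans (sym (ℤ.pos-* (2 ^ e) 2)) (cong +_ (ℕ.*-comm (2 ^ e) 2))

tracks-0 : Tracks 0 s₀
tracks-0 = record
  { window≡ = window-0
  ; e = 0
  ; j = 0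
  ; factor = refl
  ; lattice = trans (window-8odd 0)
      (trans (cong (λ v → D · (L · v)) window-0) (sym (1• _)))
  ; odd-x = 0ℤ , refl
  ; odd-u = 0ℤ , refl
  }
  where
  window-0 : window 6 0 ≡ proj₁ s₀
  window-0 rewrite β-0 {0} (s≤s z≤n) | β-0 {1} (s≤s (s≤s z≤n)) | β-0 {2} (s≤s (s≤s (s≤s z≤n)))
    | β-0 {3} (s≤s (s≤s (s≤s (s≤s z≤n)))) | β-0 {4} (s≤s (s≤s (s≤s (s≤s (s≤s z≤n))))) | β-5+ 0 = refl

-- Valuations and odd parts

record Valℕ (v m : ℕ) : Set where
  constructor _,_
  field
    q      : ℕ
    factorisation : m ≡ 2 ^ v * (1 + 2 * q)

Valℕ-* : ∀ {v w m n} → Valℕ v m → Valℕ w n → Valℕ (v + w) (m * n)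
Valℕ-* {v} {w} (q , refl) (p , refl) = q + p + 2 * (q * p) ,
  trans (expand (2 ^ v) (2 ^ w) q p) (cong (_* (1 + 2 * (q + p + 2 * (q * p)))) (sym (ℕ.^-distribˡ-+-* 2 v w)))
  where
  expand : ∀ V W q p → V * (1 + 2 * q) * (W * (1 + 2 * p)) ≡ V * W * (1 + 2 * (q + p + 2 * (q * p)))
  expand = ℕ-Solver.solve-∀

parity : ∀ n → ∃ λ h → n ≡ 2 * h ⊎ n ≡ 1 + 2 * h
parity n with n divMod 2
... | result h zero       n≡ = h , inj₁ (trans n≡ (ℕ.*-comm h 2))
... | result h (suc zero) n≡ = h , inj₂ (trans n≡ (cong suc (ℕ.*-comm h 2)))

-- Induction on `v`: the parity of `n` must match whether `v` is 0, and for even `n` both sides are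
-- halved.
Valℕ-cancel-odd : ∀ m v {n} → Valℕ v (n * (1 + 2 * m)) → Valℕ v n
Valℕ-cancel-odd m v {n} (q , eq) with parity n
Valℕ-cancel-odd m zero (q , eq) | h , inj₁ refl =
  contradiction (trans (sym (ℕ.*-assoc 2 h (1 + 2 * m))) (trans eq (ℕ.*-identityˡ _)))
    (ℕ.even≢odd (h * (1 + 2 * m)) q)
Valℕ-cancel-odd m (suc v) (q , eq) | h , inj₁ refl
  with Valℕ-cancel-odd m v {h} (q , ℕ.*-cancelˡ-≡ _ _ 2
         (trans (sym (ℕ.*-assoc 2 h (1 + 2 * m))) (trans eq (ℕ.*-assoc 2 (2 ^ v) (1 + 2 * q)))))
... | p , refl = p , sym (ℕ.*-assoc 2 (2 ^ v) (1 + 2 * p))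
Valℕ-cancel-odd m zero (q , eq) | h , inj₂ refl = h , sym (ℕ.*-identityˡ (1 + 2 * h))
Valℕ-cancel-odd m (suc v) (q , eq) | h , inj₂ refl =
  contradiction (sym (trans (sym (expand h m)) (trans eq (ℕ.*-assoc 2 (2 ^ v) (1 + 2 * q)))))
    (ℕ.even≢odd (2 ^ v * (1 + 2 * q)) (h + m + 2 * (h * m)))
  where
  expand : ∀ h m → (1 + 2 * h) * (1 + 2 * m) ≡ suc (2 * (h + m + 2 * (h * m)))
  expand = ℕ-Solver.solve-∀

-- If v < w, cancelling 2^v would equate an even number with the odd cofactor.
Valℕ-∣⇒≤ : ∀ {v w m} → Valℕ v m → 2 ^ w ∣ m → w ≤ v
Valℕ-∣⇒≤ {v} {w} (q , refl) (divides d eq) with ℕ.≤-<-connex w v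
... | inj₁ w≤v = w≤v
... | inj₂ v<w = contradiction
  (sym (ℕ.*-cancelˡ-≡ _ _ (2 ^ v) {{ℕ.m^n≢0 2 v}} (trans eq
    (trans (cong (λ i → d * 2 ^ i) (sym (ℕ.m+[n∸m]≡n v<w))) split))))
  (ℕ.even≢odd (d * 2 ^ (w ∸ suc v)) q)
  where
  rearrange : ∀ d V W → d * (2 * V * W) ≡ V * (2 * (d * W))
  rearrange = ℕ-Solver.solve-∀
  split : d * 2 ^ (suc v + (w ∸ suc v)) ≡ 2 ^ v * (2 * (d * 2 ^ (w ∸ suc v)))
  split = trans (cong (d *_) (ℕ.^-distribˡ-+-* 2 (suc v) (w ∸ suc v)))
    (rearrange d (2 ^ v) (2 ^ (w ∸ suc v)))

ν₂-Valℕ : ∀ {v} a → Valℕ v ∣ a ∣ → ν₂ a ≡ [ v ]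
ν₂-Valℕ {v} a (q , ∣a∣≡) with ν₂-largest a a≢0
  where
  a≢0 : a ≢ 0ℤ
  a≢0 refl = ℕ.m<n⇒n≢0 (ℕ.>-nonZero⁻¹ _ {{ℕ.m*n≢0 (2 ^ v) (1 + 2 * q) {{ℕ.m^n≢0 2 v}}}}) (sym ∣a∣≡)
... | w , ν≡ , 2^w∣a , max = trans ν≡ (cong [_]
  (ℕ.≤-antisym (Valℕ-∣⇒≤ (q , ∣a∣≡) 2^w∣a) (max v (divides (1 + 2 * q) (trans ∣a∣≡ (ℕ.*-comm (2 ^ v) _))))))

Odd-∣∣ : ∀ {z} → Odd z → ∃ λ q → ∣ z ∣ ≡ 1 + 2 * q
Odd-∣∣ (+ n      , refl) = n , cong (λ z → ∣ 1ℤ ℤ.+ z ∣) (sym (ℤ.pos-* 2 n))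
-- For h = -(1 + n) one has 1 + 2h = -(1 + 2n), so the witness is `n` again.
Odd-∣∣ (-[1+ n ] , refl) = n , (begin
  ∣ 1ℤ ℤ.+ + 2 ℤ.* -[1+ n ] ∣          ≡⟨ cong ∣_∣ (negate (+ n)) ⟩
  ∣ ℤ.- (1ℤ ℤ.+ + 2 ℤ.* + n) ∣         ≡⟨ ℤ.∣-i∣≡∣i∣ (1ℤ ℤ.+ + 2 ℤ.* + n) ⟩
  ∣ 1ℤ ℤ.+ + 2 ℤ.* + n ∣               ≡⟨ cong (λ z → ∣ 1ℤ ℤ.+ z ∣) (ℤ.pos-* 2 n) ⟨
  1 + 2 * n                            ∎)
  where
  open ≡-Reasoning
  negate : ∀ m → 1ℤ ℤ.+ + 2 ℤ.* (ℤ.- (1ℤ ℤ.+ m)) ≡ ℤ.- (1ℤ ℤ.+ + 2 ℤ.* m)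
  negate = solve-∀

Odd⇒Valℕ : ∀ v {z} → Odd z → Valℕ v ∣ + (2 ^ v) ℤ.* z ∣
Odd⇒Valℕ v {z} odd-z with Odd-∣∣ odd-z
... | q , ∣z∣≡ = q , trans (ℤ.abs-* (+ (2 ^ v)) z) (cong (2 ^ v *_) ∣z∣≡)

ν₂-2^* : ∀ v {z} → Odd z → ν₂ (+ (2 ^ v) ℤ.* z) ≡ [ v ]
ν₂-2^* v {z} odd-z = ν₂-Valℕ (+ (2 ^ v) ℤ.* z) (Odd⇒Valℕ v odd-z)

-- Two residues differ by a multiple of `d` of absolute value below `d`, hence by 0.
%ℕ-unique : ∀ d .{{_ : NonZero d}} a {r} q → r < d → a ≡ + r ℤ.+ q ℤ.* + d → a %ℕ d ≡ r
%ℕ-unique d a {r} q r<d a≡ = ℤ.+-injective (ℤ.i-j≡0⇒i≡j _ _ (ℤ.∣i∣≡0⇒i≡0 (small multiple bound)))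
  where
  small : ∀ {m} → d ∣ m → m < d → m ≡ 0
  small {zero}  _   _   = refl
  small {suc m} d∣m m<d = contradiction d∣m (>⇒∤ m<d)
  difference : + (a %ℕ d) ℤ.- + r ≡ (q ℤ.- a /ℕ d) ℤ.* + d
  difference = begin
    + (a %ℕ d) ℤ.- + r
      ≡⟨ add (+ (a %ℕ d)) (+ r) (a /ℕ d ℤ.* + d) ⟩
    (+ (a %ℕ d) ℤ.+ a /ℕ d ℤ.* + d) ℤ.- (+ r ℤ.+ a /ℕ d ℤ.* + d)
      ≡⟨ cong (ℤ._- (+ r ℤ.+ a /ℕ d ℤ.* + d)) (trans (sym (a≡a%ℕn+[a/ℕn]*n a d)) a≡) ⟩
    (+ r ℤ.+ q ℤ.* + d) ℤ.- (+ r ℤ.+ a /ℕ d ℤ.* + d)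
      ≡⟨ collect (+ r) q (a /ℕ d) (+ d) ⟩
    (q ℤ.- a /ℕ d) ℤ.* + d ∎
    where
    open ≡-Reasoning
    add : ∀ x y z → x ℤ.- y ≡ (x ℤ.+ z) ℤ.- (y ℤ.+ z)
    add = solve-∀
    collect : ∀ r q p d → (r ℤ.+ q ℤ.* d) ℤ.- (r ℤ.+ p ℤ.* d) ≡ (q ℤ.- p) ℤ.* d
    collect = solve-∀
  multiple : d ∣ ∣ + (a %ℕ d) ℤ.- + r ∣
  multiple = divides ∣ q ℤ.- a /ℕ d ∣ (trans (cong ∣_∣ difference) (ℤ.abs-* (q ℤ.- a /ℕ d) (+ d)))
  bound : ∣ + (a %ℕ d) ℤ.- + r ∣ < d
  bound = ℕ.≤-<-trans
    (subst (λ z → ∣ z ∣ ≤ (a %ℕ d) ℕ.⊔ r) (sym (ℤ.m-n≡m⊖n (a %ℕ d) r)) (ℤ.∣m⊝n∣≤m⊔n (a %ℕ d) r))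
    (ℕ.⊔-pres-<m (n%ℕd<d a d) r<d)

*-/ℕ : ∀ d .{{_ : NonZero d}} z → (+ d ℤ.* z) /ℕ d ≡ z
*-/ℕ d z = ℤ.*-cancelʳ-≡ _ z (+ d) {{ℕ-nz d}} (begin
  a /ℕ d ℤ.* + d                    ≡⟨ ℤ.+-identityˡ _ ⟨
  + 0 ℤ.+ a /ℕ d ℤ.* + d            ≡⟨ cong (λ r → + r ℤ.+ a /ℕ d ℤ.* + d) a%d≡0 ⟨
  + (a %ℕ d) ℤ.+ a /ℕ d ℤ.* + d     ≡⟨ a≡a%ℕn+[a/ℕn]*n a d ⟨
  + d ℤ.* z                         ≡⟨ ℤ.*-comm (+ d) z ⟩
  z ℤ.* + d                         ∎)
  where
  open ≡-Reasoning
  a = + d ℤ.* z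
  ℕ-nz : ∀ d .{{_ : NonZero d}} → ℤ.NonZero (+ d)
  ℕ-nz (suc _) = _
  a%d≡0 : a %ℕ d ≡ 0
  a%d≡0 = %ℕ-unique d a z (ℕ.>-nonZero⁻¹ d) (trans (ℤ.*-comm (+ d) z) (sym (ℤ.+-identityˡ _)))

odd-/ℕ : ∀ {v} a → ν₂ a ≡ [ v ] → odd a ≡ _/ℕ_ a (2 ^ v) {{ℕ.m^n≢0 2 v}}
odd-/ℕ a ν≡ with ν₂ a | ν≡
... | _ | refl = refl

odd-2^* : ∀ v {z} → Odd z → odd (+ (2 ^ v) ℤ.* z) ≡ z
odd-2^* v {z} odd-z = trans (odd-/ℕ (+ (2 ^ v) ℤ.* z) (ν₂-2^* v odd-z)) (*-/ℕ (2 ^ v) {{ℕ.m^n≢0 2 v}} z)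

-- The binomial coefficient as a product of five consecutive integers

binomial-5 : ∀ n → ((n + 5) C 5) * 120 ≡ (5 + n) * ((4 + n) * ((3 + n) * ((2 + n) * (1 + n))))
binomial-5 n = ℕ.*-cancelʳ-≡ _ _ (n !) {{ℕ._!≢0 n}} (begin
  ((n + 5) C 5) * 120 * n !               ≡⟨ ℕ.*-assoc ((n + 5) C 5) 120 (n !) ⟩
  -- Writing n as (n + 5) - 5 turns 120 * n ! into the denominator of the factorial formula.
  ((n + 5) C 5) * (120 * n !)             ≡⟨ cong (λ m → ((n + 5) C 5) * (120 * m !)) (ℕ.m+n∸n≡m n 5) ⟨
  ((n + 5) C 5) * d                       ≡⟨ cong (_* d) (nCk≡n!/k![n-k]! 5≤n+5) ⟩
  ((n + 5) ! / d) * d                   ≡⟨ m/n*n≡m d∣ ⟩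
  (n + 5) !                             ≡⟨ cong _! (ℕ.+-comm n 5) ⟩
  (5 + n) !                             ≡⟨ regroup n (n !) ⟩
  (5 + n) * ((4 + n) * ((3 + n) * ((2 + n) * (1 + n)))) * n ! ∎)
  where
  open ≡-Reasoning
  d = 5 ! * (n + 5 ∸ 5) !
  instance
    d≢0 : NonZero d
    d≢0 = ℕ.m*n≢0 (5 !) _ {{_}} {{ℕ._!≢0 (n + 5 ∸ 5)}}
  5≤n+5 : 5 ≤ n + 5
  5≤n+5 = ℕ.m≤n+m 5 n
  d∣ : d ∣ (n + 5) !
  d∣ = subst (_∣ (n + 5) !) (ℕ.*-comm ((n + 5 ∸ 5) !) (5 !)) ([n∸k]!k!∣n! 5≤n+5)
  regroup : ∀ n f → (5 + n) * ((4 + n) * ((3 + n) * ((2 + n) * ((1 + n) * f)))) ≡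
    (5 + n) * ((4 + n) * ((3 + n) * ((2 + n) * (1 + n)))) * f
  regroup = ℕ-Solver.solve-∀

-- As 5! = 8 * 15, the valuation is the sum of those of the five factors minus 3, once the odd
-- factor 15 = 1 + 2 * 7 is cancelled.
Valℕ-binomial : ∀ n {v a₁ a₂ a₃ a₄ a₅} →
  Valℕ a₅ (5 + n) → Valℕ a₄ (4 + n) → Valℕ a₃ (3 + n) → Valℕ a₂ (2 + n) → Valℕ a₁ (1 + n) →
  a₅ + (a₄ + (a₃ + (a₂ + a₁))) ≡ 3 + v → Valℕ v ((n + 5) C 5)
Valℕ-binomial n {v} V₅ V₄ V₃ V₂ V₁ sum≡
  with subst (λ a → Valℕ a ((5 + n) * ((4 + n) * ((3 + n) * ((2 + n) * (1 + n)))))) sum≡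
         (Valℕ-* V₅ (Valℕ-* V₄ (Valℕ-* V₃ (Valℕ-* V₂ V₁))))
... | q , eq = Valℕ-cancel-odd 7 v (q , ℕ.*-cancelˡ-≡ _ _ 8 (begin
  8 * (((n + 5) C 5) * 15)      ≡⟨ regroup ((n + 5) C 5) ⟩
  ((n + 5) C 5) * 120             ≡⟨ binomial-5 n ⟩
  (5 + n) * ((4 + n) * ((3 + n) * ((2 + n) * (1 + n))))  ≡⟨ eq ⟩
  2 ^ (3 + v) * (1 + 2 * q)     ≡⟨ cong (_* (1 + 2 * q)) (ℕ.^-distribˡ-+-* 2 3 v) ⟩
  8 * 2 ^ v * (1 + 2 * q)       ≡⟨ ℕ.*-assoc 8 (2 ^ v) (1 + 2 * q) ⟩
  8 * (2 ^ v * (1 + 2 * q))     ∎))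
  where
  open ≡-Reasoning
  regroup : ∀ c → 8 * (c * 15) ≡ c * 120
  regroup = ℕ-Solver.solve-∀

-- Reading t₆ off x and u

-- The rows 1, 2, 3 of B² A₁′ divided by 1, 2, 1.
G : Matrix 3 6
G = (+ 9     ∷ ℤ.- + 627 ∷ ℤ.- + 2814 ∷ ℤ.- + 462  ∷ + 309     ∷ + 1     ∷ [])
  ∷ (ℤ.- + 3 ∷ ℤ.- + 7   ∷ + 1290     ∷ + 1290     ∷ ℤ.- + 7   ∷ ℤ.- + 3 ∷ [])
  ∷ (+ 1     ∷ + 309     ∷ ℤ.- + 462  ∷ ℤ.- + 2814 ∷ ℤ.- + 627 ∷ + 9     ∷ [])
  ∷ []

-- The rows of D divided by 16, 2, 4, 2, 16.
H : Matrix 5 5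
H = (+ 1   ∷ + 0    ∷ + 0    ∷ + 0   ∷ + 0    ∷ [])
  ∷ (+ 7   ∷ + 8    ∷ + 0    ∷ + 0   ∷ + 0    ∷ [])
  ∷ (+ 87  ∷ + 40   ∷ + 128  ∷ + 0   ∷ + 0    ∷ [])
  ∷ (+ 135 ∷ + 72   ∷ + 256  ∷ + 512 ∷ + 0    ∷ [])
  ∷ (+ 161 ∷ + 2032 ∷ + 1792 ∷ + 128 ∷ + 2048 ∷ [])
  ∷ []

-- For n = 8k + r, the odd part of t₆ n is read off x when r ≤ 2, from
-- V(4(2k + 1)), and off u when r ≥ 3, from V(8(k + 1)).
form : Bit → Bit → Bit → Vec ℤ 6 ⊎ Vec ℤ 5
form zero       zero       zero       = inj₁ (lookup G (# 0))
form zero       zero       (suc zero) = inj₁ (lookup G (# 1))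
form zero       (suc zero) zero       = inj₁ (lookup G (# 2))
form zero       (suc zero) (suc zero) = inj₂ (lookup H (# 0))
form (suc zero) zero       zero       = inj₂ (lookup H (# 1))
form (suc zero) zero       (suc zero) = inj₂ (lookup H (# 2))
form (suc zero) (suc zero) zero       = inj₂ (lookup H (# 3))
form (suc zero) (suc zero) (suc zero) = inj₂ (lookup H (# 4))

eval : Vec ℤ 6 ⊎ Vec ℤ 5 → State → ℤ
eval f (x , u) = [ _⊡ x , _⊡ u ]′ f

-- The valuation of the binomial coefficient, where 2^e is the exact power of 2
-- dividing k + 1.
exponent : Bit → Bit → Bit → ℕ → ℕ
exponent zero       zero       zero       e = 0
exponent zero       zero       (suc zero) e = 1
exponent zero       (suc zero) zero       e = 0
exponent zero       (suc zero) (suc zero) e = 3 + e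
exponent (suc zero) zero       zero       e = 1 + e
exponent (suc zero) zero       (suc zero) e = 2 + e
exponent (suc zero) (suc zero) zero       e = 1 + e
exponent (suc zero) (suc zero) (suc zero) e = 3 + e

fromBits : ℕ → Bit → Bit → Bit → ℕ
fromBits k d₂ d₁ d₀ = toℕ d₀ + (toℕ d₁ + (toℕ d₂ + k * 2) * 2) * 2

eval-odd : ∀ {k s} → Tracks k s → ∀ d₂ d₁ d₀ → Odd (eval (form d₂ d₁ d₀) s)
eval-odd {s = x , u} t zero       zero       zero       = Odd-⊡ (lookup G (# 0)) ξ x refl (Tracks.odd-x t)
eval-odd {s = x , u} t zero       zero       (suc zero) = Odd-⊡ (lookup G (# 1)) ξ x refl (Tracks.odd-x t)
eval-odd {s = x , u} t zero       (suc zero) zero       = Odd-⊡ (lookup G (# 2)) ξ x refl (Tracks.odd-x t)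
eval-odd {s = x , u} t zero       (suc zero) (suc zero) = Odd-⊡ (lookup H (# 0)) υ u refl (Tracks.odd-u t)
eval-odd {s = x , u} t (suc zero) zero       zero       = Odd-⊡ (lookup H (# 1)) υ u refl (Tracks.odd-u t)
eval-odd {s = x , u} t (suc zero) zero       (suc zero) = Odd-⊡ (lookup H (# 2)) υ u refl (Tracks.odd-u t)
eval-odd {s = x , u} t (suc zero) (suc zero) zero       = Odd-⊡ (lookup H (# 3)) υ u refl (Tracks.odd-u t)
eval-odd {s = x , u} t (suc zero) (suc zero) (suc zero) = Odd-⊡ (lookup H (# 4)) υ u refl (Tracks.odd-u t)

lookup-window-4odd : ∀ {k s} → Tracks k s → ∀ i (r : Vec ℤ 6) v →
  lookup (B ⊠ (B ⊠ take 5 A₁)) i ≡ + (2 ^ v) • r →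
  lookup (window 5 ((1 + k * 2) * 2 * 2)) i ≡ + (2 ^ v) ℤ.* r ⊡ proj₁ s
lookup-window-4odd {k} {x , u} (tracks refl _ _ _ _ _ _) i r v row≡ = begin
  lookup (window 5 ((1 + k * 2) * 2 * 2)) i
    ≡⟨ cong (λ w → lookup w i) (window-4odd k) ⟩
  lookup ((B ⊠ (B ⊠ take 5 A₁)) · x) i
    ≡⟨ Vec.lookup-map i (_⊡ x) (B ⊠ (B ⊠ take 5 A₁)) ⟩
  lookup (B ⊠ (B ⊠ take 5 A₁)) i ⊡ x
    ≡⟨ cong (_⊡ x) row≡ ⟩
  (+ (2 ^ v) • r) ⊡ x
    ≡⟨ •-⊡ (+ (2 ^ v)) r x ⟩
  + (2 ^ v) ℤ.* r ⊡ x ∎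
  where open ≡-Reasoning

lookup-window-8 : ∀ {k s} (t : Tracks k s) → ∀ i (r : Vec ℤ 5) a {v} → v ≡ a + Tracks.e t →
  lookup D i ≡ + (2 ^ a) • r →
  lookup (window 5 (suc k * 2 * 2 * 2)) i ≡ + (2 ^ v) ℤ.* r ⊡ proj₂ s
lookup-window-8 {k} {x , u} (tracks _ e _ _ lattice _ _) i r a {v} v≡ row≡ = begin
  lookup (window 5 (suc k * 2 * 2 * 2)) i
    ≡⟨ cong (λ w → lookup w i) lattice ⟩
  lookup (+ (2 ^ e) • (D · u)) i
    ≡⟨ Vec.lookup-map i (ℤ._*_ (+ (2 ^ e))) (D · u) ⟩
  + (2 ^ e) ℤ.* lookup (D · u) i
    ≡⟨ cong (ℤ._*_ (+ (2 ^ e))) (Vec.lookup-map i (_⊡ u) D) ⟩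
  + (2 ^ e) ℤ.* lookup D i ⊡ u
    ≡⟨ cong (λ w → + (2 ^ e) ℤ.* w ⊡ u) row≡ ⟩
  + (2 ^ e) ℤ.* (+ (2 ^ a) • r) ⊡ u
    ≡⟨ cong (ℤ._*_ (+ (2 ^ e))) (•-⊡ (+ (2 ^ a)) r u) ⟩
  + (2 ^ e) ℤ.* (+ (2 ^ a) ℤ.* r ⊡ u)
    ≡⟨ ℤ.*-assoc (+ (2 ^ e)) (+ (2 ^ a)) (r ⊡ u) ⟨
  + (2 ^ e) ℤ.* + (2 ^ a) ℤ.* r ⊡ u
    ≡⟨ cong (ℤ._* r ⊡ u) 2^e*2^a ⟩
  + (2 ^ v) ℤ.* r ⊡ u ∎
  where
  open ≡-Reasoning
  2^e*2^a : + (2 ^ e) ℤ.* + (2 ^ a) ≡ + (2 ^ v)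
  2^e*2^a = trans (sym (ℤ.pos-* (2 ^ e) (2 ^ a))) (cong +_
    (trans (sym (ℕ.^-distribˡ-+-* 2 e a)) (cong (2 ^_) (trans (ℕ.+-comm e a) (sym v≡)))))

t₆-factor : ∀ {k s} (t : Tracks k s) d₂ d₁ d₀ →
  t₆ (fromBits k d₂ d₁ d₀) ≡
  + (2 ^ (exponent d₂ d₁ d₀ (Tracks.e t) + 𝟏 (toℕ d₀ + toℕ d₁ * 2 ℕ.≟ 3))) ℤ.* eval (form d₂ d₁ d₀) s
t₆-factor {k} t d₂ d₁ d₀ = trans (sym (β-5+ (fromBits k d₂ d₁ d₀))) (β-factor d₂ d₁ d₀)
  where
  β-factor : ∀ d₂ d₁ d₀ → β (5 + fromBits k d₂ d₁ d₀) ≡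
    + (2 ^ (exponent d₂ d₁ d₀ (Tracks.e t) + 𝟏 (toℕ d₀ + toℕ d₁ * 2 ℕ.≟ 3))) ℤ.* eval (form d₂ d₁ d₀) _
  -- For n = 8k + r, 5 + n = 4(2k + 1) + (r + 1) = 8(k + 1) + (r - 3), which gives the row used in
  -- each case.
  β-factor zero       zero       zero       = lookup-window-4odd t (# 1) (lookup G (# 0)) 0 refl
  β-factor zero       zero       (suc zero) = lookup-window-4odd t (# 2) (lookup G (# 1)) 1 refl
  β-factor zero       (suc zero) zero       = lookup-window-4odd t (# 3) (lookup G (# 2)) 0 refl
  -- Rows 0 and 4 of `D` carry 2⁴, one factor more than the 3 in the binomial exponent; these are
  -- the cases n ≡ 3 (mod 4), where the indicator is 1.
  β-factor zero       (suc zero) (suc zero) =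
    lookup-window-8 t (# 0) (lookup H (# 0)) 4 (ℕ.+-comm (3 + Tracks.e t) 1) refl
  β-factor (suc zero) zero       zero       =
    lookup-window-8 t (# 1) (lookup H (# 1)) 1 (ℕ.+-identityʳ (1 + Tracks.e t)) refl
  β-factor (suc zero) zero       (suc zero) =
    lookup-window-8 t (# 2) (lookup H (# 2)) 2 (ℕ.+-identityʳ (2 + Tracks.e t)) refl
  β-factor (suc zero) (suc zero) zero       =
    lookup-window-8 t (# 3) (lookup H (# 3)) 1 (ℕ.+-identityʳ (1 + Tracks.e t)) refl
  β-factor (suc zero) (suc zero) (suc zero) =
    lookup-window-8 t (# 4) (lookup H (# 4)) 4 (ℕ.+-comm (3 + Tracks.e t) 1) refl

module _ {k s} (t : Tracks k s) where
  open Tracks t using (e; j; factor)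

  private
    8k : ℕ
    8k = k * 2 * 2 * 2

    odd-term : ∀ i → Valℕ 0 (1 + 2 * i + 8k)
    odd-term i = i + k * 4 , expand i k
      where
      expand : ∀ i k → 1 + 2 * i + k * 2 * 2 * 2 ≡ 1 * (1 + 2 * (i + k * 4))
      expand = ℕ-Solver.solve-∀

    2mod4-term : ∀ i → Valℕ 1 (2 + 4 * i + 8k)
    2mod4-term i = i + k * 2 , expand i k
      where
      expand : ∀ i k → 2 + 4 * i + k * 2 * 2 * 2 ≡ 2 * (1 + 2 * (i + k * 2))
      expand = ℕ-Solver.solve-∀

    4mod8-term : ∀ i → Valℕ 2 (4 + 8 * i + 8k)
    4mod8-term i = i + k , expand i k
      where
      expand : ∀ i k → 4 + 8 * i + k * 2 * 2 * 2 ≡ 4 * (1 + 2 * (i + k))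
      expand = ℕ-Solver.solve-∀

    0mod8-term : Valℕ (3 + e) (8 + 8k)
    0mod8-term = j , trans (cong (λ m → m * 2 * 2 * 2) factor)
      (trans (regroup (2 ^ e) j) (cong (_* (1 + 2 * j)) (sym (ℕ.^-distribˡ-+-* 2 3 e))))
      where
      regroup : ∀ P j → P * (1 + j * 2) * 2 * 2 * 2 ≡ 8 * P * (1 + 2 * j)
      regroup = ℕ-Solver.solve-∀

  -- The residue modulo 8 fixes the valuation of each of n + 1, ..., n + 5 except 8(k + 1), which
  -- occurs exactly when n mod 8 ≥ 3 and has valuation 3 + e.
  binomial-exponent : ∀ d₂ d₁ d₀ → Valℕ (exponent d₂ d₁ d₀ e) ((fromBits k d₂ d₁ d₀ + 5) C 5)
  binomial-exponent zero       zero       zero       = Valℕ-binomial 8k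
    (odd-term 2) (4mod8-term 0) (odd-term 1) (2mod4-term 0) (odd-term 0) refl
  binomial-exponent zero       zero       (suc zero) = Valℕ-binomial (1 + 8k)
    (2mod4-term 1) (odd-term 2) (4mod8-term 0) (odd-term 1) (2mod4-term 0) refl
  binomial-exponent zero       (suc zero) zero       = Valℕ-binomial (2 + 8k)
    (odd-term 3) (2mod4-term 1) (odd-term 2) (4mod8-term 0) (odd-term 1) refl
  binomial-exponent zero       (suc zero) (suc zero) = Valℕ-binomial (3 + 8k)
    0mod8-term (odd-term 3) (2mod4-term 1) (odd-term 2) (4mod8-term 0) (ℕ.+-comm (3 + e) 3)
  binomial-exponent (suc zero) zero       zero       = Valℕ-binomial (4 + 8k)
    (odd-term 4) 0mod8-term (odd-term 3) (2mod4-term 1) (odd-term 2) (ℕ.+-comm (3 + e) 1)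
  binomial-exponent (suc zero) zero       (suc zero) = Valℕ-binomial (5 + 8k)
    (2mod4-term 2) (odd-term 4) 0mod8-term (odd-term 3) (2mod4-term 1) (cong suc (ℕ.+-comm (3 + e) 1))
  binomial-exponent (suc zero) (suc zero) zero       = Valℕ-binomial (6 + 8k)
    (odd-term 5) (2mod4-term 2) (odd-term 4) 0mod8-term (odd-term 3) (cong suc (ℕ.+-identityʳ (3 + e)))
  binomial-exponent (suc zero) (suc zero) (suc zero) = Valℕ-binomial (7 + 8k)
    (4mod8-term 1) (odd-term 5) (2mod4-term 2) (odd-term 4) 0mod8-term refl

mod4 : ∀ m d₁ d₀ → (toℕ d₀ + (toℕ d₁ + m * 2) * 2) % 4 ≡ toℕ {2} d₀ + toℕ {2} d₁ * 2
mod4 m d₁ d₀ = trans (cong (_% 4) (regroup (toℕ d₀) (toℕ d₁) m))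
  (trans ([m+kn]%n≡m%n (toℕ d₀ + toℕ d₁ * 2) m 4) (small d₁ d₀))
  where
  regroup : ∀ a b m → a + (b + m * 2) * 2 ≡ a + b * 2 + m * 4
  regroup = ℕ-Solver.solve-∀
  small : ∀ d₁ d₀ → (toℕ {2} d₀ + toℕ {2} d₁ * 2) % 4 ≡ toℕ d₀ + toℕ d₁ * 2
  small zero       zero       = refl
  small zero       (suc zero) = refl
  small (suc zero) zero       = refl
  small (suc zero) (suc zero) = refl

ν₂-t₆ : ∀ {k s} → Tracks k s → ∀ d₂ d₁ d₀ → let n = fromBits k d₂ d₁ d₀ in
  ν₂ (t₆ n) ≡ ν₂ (+ ((n + 5) C 5)) +⁺ [ 𝟏 (n % 4 ℕ.≟ 3) ]
ν₂-t₆ {k} {s} t d₂ d₁ d₀ = begin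
  ν₂ (t₆ n)
    ≡⟨ cong ν₂ (t₆-factor t d₂ d₁ d₀) ⟩
  ν₂ (+ (2 ^ (w + 𝟏 (toℕ d₀ + toℕ d₁ * 2 ℕ.≟ 3))) ℤ.* eval (form d₂ d₁ d₀) s)
    ≡⟨ ν₂-2^* (w + 𝟏 (toℕ d₀ + toℕ d₁ * 2 ℕ.≟ 3)) (eval-odd t d₂ d₁ d₀) ⟩
  [ w ] +⁺ [ 𝟏 (toℕ d₀ + toℕ d₁ * 2 ℕ.≟ 3) ]
    ≡⟨ cong₂ (λ v r → v +⁺ [ 𝟏 (r ℕ.≟ 3) ]) (ν₂-Valℕ (+ ((n + 5) C 5)) (binomial-exponent t d₂ d₁ d₀))
         (mod4 (toℕ d₂ + k * 2) d₁ d₀) ⟨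
  ν₂ (+ ((n + 5) C 5)) +⁺ [ 𝟏 (n % 4 ℕ.≟ 3) ] ∎
  where
  open ≡-Reasoning
  n = fromBits k d₂ d₁ d₀
  w = exponent d₂ d₁ d₀ (Tracks.e t)

odd-t₆ : ∀ {k s} → Tracks k s → ∀ d₂ d₁ d₀ → odd (t₆ (fromBits k d₂ d₁ d₀)) ≡ eval (form d₂ d₁ d₀) s
odd-t₆ t d₂ d₁ d₀ = trans (cong odd (t₆-factor t d₂ d₁ d₀))
  (odd-2^* (exponent d₂ d₁ d₀ (Tracks.e t) + _) (eval-odd t d₂ d₁ d₀))

-- Automata

-- Digit lists start with the least significant digit, so `foldr` consumes the most significant one
-- first, and each step replaces the number read by its double plus the digit.
run-invariant : ∀ {a r} {A : Set a} (step : A → Bit → A) (start : A) (R : ℕ → A → Set r) →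
  R 0 start → (∀ {n a} → R n a → ∀ b → R (toℕ b + n * 2) (step a b)) →
  ∀ ds → R (fromDigits ds) (foldr (flip step) start ds)
run-invariant step start R R₀ Rₛ []       = R₀
run-invariant step start R R₀ Rₛ (b ∷ ds) = Rₛ (run-invariant step start R R₀ Rₛ ds) b

-- The automaton runs on codes in `Fin m`. Because `to` undoes `from`, a relation between numbers
-- and elements of `A` pulls back along `to` to an invariant of the coded run.
automatic : ∀ {A : Set} {m k} → Fin m ↩ A →
  (step : A → Bit → A) (start : A) (output : A → Fin k) (R : ℕ → A → Set) →
  R 0 start → (∀ {n a} → R n a → ∀ b → R (toℕ b + n * 2) (step a b)) →
  (f : ℕ → Fin k) → (∀ {n a} → R n a → output a ≡ f n) → Is2Automatic f
automatic {m = m} enc step start output R R₀ Rₛ f Rₒ = M , correct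
  where
  open LeftInverse enc
  step′ : Fin m → Bit → Fin m
  step′ i b = from (step (to i) b)
  R′ : ℕ → Fin m → Set
  R′ n i = R n (to i)
  start-invariant : R′ 0 (from start)
  start-invariant = subst (R 0) (sym (strictlyInverseˡ start)) R₀
  step-invariant : ∀ {n i} → R′ n i → ∀ b → R′ (toℕ b + n * 2) (step′ i b)
  step-invariant {i = i} r b = subst (R _) (sym (strictlyInverseˡ (step (to i) b))) (Rₛ r b)
  M : Automaton _
  M = record { #states = m ; start = from start ; step = step′ ; output = output ∘ to }
  correct : ∀ n → Automaton.run M (binary n) ≡ f n
  correct n with toDigits 2 n
  ... | ds , ds≡n = trans (cong (output ∘ to) (reverse-foldl step′ (from start) ds))
    (Rₒ (subst (λ j → R′ j (foldr (flip step′) (from start) ds)) ds≡n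
      (run-invariant step′ (from start) R′ start-invariant step-invariant ds)))

Fin-×-↩ : ∀ {A B : Set} {m n} → Fin m ↩ A → Fin n ↩ B → Fin (m * n) ↩ (A × B)
Fin-×-↩ {n = n} e f = (e ×-↩ f) ↩-∘
  mk↩ {to = remQuot n} {from = λ (i , j) → combine i j} λ { refl → Fin.remQuot-combine _ _ }

Fin-Vec-↩ : ∀ n q → Fin (q ^ n) ↩ Vec (Fin q) n
Fin-Vec-↩ n q = mk↩ {to = tabulate ∘ finToFun} {from = funToFin ∘ lookup} λ { {v} refl →
  trans (Vec.tabulate-cong (Fin.finToFun-funToFin (lookup v))) (Vec.tabulate∘lookup v) }

-- Running the integer-valued `step` over the digits of `k` reaches such a state.
tracked : ∀ k → ∃ (Tracks k)
tracked k with toDigits 2 k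
... | ds , refl = _ , run-invariant step s₀ Tracks tracks-0 tracks-step ds

last-bit : ∀ n → ∃₂ λ m (b : Bit) → n ≡ toℕ b + m * 2
last-bit n with n divMod 2
... | result m b n≡ = m , b , n≡

last-three-bits : ∀ n → ∃ λ k → ∃ λ d₂ → ∃₂ λ d₁ d₀ → n ≡ fromBits k d₂ d₁ d₀
last-three-bits n with last-bit n
... | n₁ , d₀ , refl with last-bit n₁
... | n₂ , d₁ , refl with last-bit n₂
... | k , d₂ , refl = k , d₂ , d₁ , d₀ , refl

-- Reduction of the states modulo 2^s

module _ (s : ℕ) where
  private
    instance
      2^s≢0 : NonZero (2 ^ s)
      2^s≢0 = ℕ.m^n≢0 2 s

  lift : ∀ {m} → Vec (Fin (2 ^ s)) m → Vec ℤ m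
  lift = map (+_ ∘ toℕ)

  reduce : ∀ {m} → Vec ℤ m → Vec (Fin (2 ^ s)) m
  reduce = map (_mod2^ s)

  toℕ-mod2^ : ∀ a → toℕ (a mod2^ s) ≡ a %ℕ (2 ^ s)
  toℕ-mod2^ a = Fin.toℕ-fromℕ< (n%ℕd<d a (2 ^ s))

  mod2^-periodic : ∀ a b → (a ℤ.+ b ℤ.* + (2 ^ s)) mod2^ s ≡ a mod2^ s
  mod2^-periodic a b = Fin.toℕ-injective (begin
    toℕ ((a ℤ.+ b ℤ.* + (2 ^ s)) mod2^ s)     ≡⟨ toℕ-mod2^ (a ℤ.+ b ℤ.* + (2 ^ s)) ⟩
    (a ℤ.+ b ℤ.* + (2 ^ s)) %ℕ (2 ^ s)
      ≡⟨ %ℕ-unique (2 ^ s) _ (a /ℕ (2 ^ s) ℤ.+ b) (n%ℕd<d a (2 ^ s))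
           (trans (cong (ℤ._+ b ℤ.* + (2 ^ s)) (a≡a%ℕn+[a/ℕn]*n a (2 ^ s)))
             (collect (+ (a %ℕ (2 ^ s))) (a /ℕ (2 ^ s)) b (+ (2 ^ s)))) ⟩
    a %ℕ (2 ^ s)                              ≡⟨ toℕ-mod2^ a ⟨
    toℕ (a mod2^ s)                           ∎)
    where
    open ≡-Reasoning
    collect : ∀ r p b d → (r ℤ.+ p ℤ.* d) ℤ.+ b ℤ.* d ≡ r ℤ.+ (p ℤ.+ b) ℤ.* d
    collect = solve-∀

  -- A linear form modulo 2^s depends only on the residues of its argument; the quotients of the
  -- entries supply the multiple of 2^s explicitly.
  ⊡-lift-reduce : ∀ {m} (r v : Vec ℤ m) → ∃ λ b → r ⊡ v ≡ r ⊡ lift (reduce v) ℤ.+ b ℤ.* + (2 ^ s)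
  ⊡-lift-reduce []      []      = 0ℤ , refl
  ⊡-lift-reduce (a ∷ r) (x ∷ v) with ⊡-lift-reduce r v
  ... | b , r⊡v≡ = a ℤ.* (x /ℕ (2 ^ s)) ℤ.+ b , (begin
    a ℤ.* x ℤ.+ r ⊡ v
      ≡⟨ cong₂ (λ y z → a ℤ.* y ℤ.+ z) x≡ r⊡v≡ ⟩
    a ℤ.* (+ toℕ (x mod2^ s) ℤ.+ x /ℕ (2 ^ s) ℤ.* + (2 ^ s)) ℤ.+ (r ⊡ lift (reduce v) ℤ.+ b ℤ.* + (2 ^ s))
      ≡⟨ collect a (+ toℕ (x mod2^ s)) (x /ℕ (2 ^ s)) (+ (2 ^ s)) (r ⊡ lift (reduce v)) b ⟩
    a ℤ.* + toℕ (x mod2^ s) ℤ.+ r ⊡ lift (reduce v) ℤ.+ (a ℤ.* (x /ℕ (2 ^ s)) ℤ.+ b) ℤ.* + (2 ^ s) ∎)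
    where
    open ≡-Reasoning
    x≡ : x ≡ + toℕ (x mod2^ s) ℤ.+ x /ℕ (2 ^ s) ℤ.* + (2 ^ s)
    x≡ = trans (a≡a%ℕn+[a/ℕn]*n x (2 ^ s))
      (cong (λ i → + i ℤ.+ x /ℕ (2 ^ s) ℤ.* + (2 ^ s)) (sym (toℕ-mod2^ x)))
    collect : ∀ a t p d z b → a ℤ.* (t ℤ.+ p ℤ.* d) ℤ.+ (z ℤ.+ b ℤ.* d) ≡
      a ℤ.* t ℤ.+ z ℤ.+ (a ℤ.* p ℤ.+ b) ℤ.* d
    collect = solve-∀

  ⊡-mod2^ : ∀ {m} (r v : Vec ℤ m) → (r ⊡ lift (reduce v)) mod2^ s ≡ (r ⊡ v) mod2^ s
  ⊡-mod2^ r v with ⊡-lift-reduce r v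
  ... | b , r⊡v≡ = sym (trans (cong (_mod2^ s) r⊡v≡) (mod2^-periodic (r ⊡ lift (reduce v)) b))

  ·-mod2^ : ∀ {m n} (M : Matrix m n) v → reduce (M · lift (reduce v)) ≡ reduce (M · v)
  ·-mod2^ []      v = refl
  ·-mod2^ (r ∷ M) v = cong₂ _∷_ (⊡-mod2^ r v) (·-mod2^ M v)

  Residues : Set
  Residues = Vec (Fin (2 ^ s)) 6 × Vec (Fin (2 ^ s)) 5

  liftState : Residues → State
  liftState (x , u) = lift x , lift u

  reduceState : State → Residues
  reduceState (x , u) = reduce x , reduce u

  step-mod2^ : ∀ y b → reduceState (step (liftState (reduceState y)) b) ≡ reduceState (step y b)
  step-mod2^ (x , u) zero       = cong₂ _,_ (·-mod2^ A₀ x) (·-mod2^ L x)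
  step-mod2^ (x , u) (suc zero) = cong₂ _,_ (·-mod2^ A₁ x) (·-mod2^ R u)

  eval-mod2^ : ∀ f y → eval f (liftState (reduceState y)) mod2^ s ≡ eval f y mod2^ s
  eval-mod2^ (inj₁ r) (x , u) = ⊡-mod2^ r x
  eval-mod2^ (inj₂ r) (x , u) = ⊡-mod2^ r u

  -- The form to evaluate depends on the last three digits of `n`, so these are kept in a buffer
  -- while the residues belong to `k`, the quotient of `n` by 8.
  Reads : ℕ → Residues × Bit × Bit × Bit → Set
  Reads n (y , d₂ , d₁ , d₀) =
    ∃₂ λ k z → Tracks k z × y ≡ reduceState z × n ≡ fromBits k d₂ d₁ d₀

  odd-t₆-automatic : Is2Automatic (λ n → odd (t₆ n) mod2^ s)
  odd-t₆-automatic = automatic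
    (Fin-×-↩ (Fin-×-↩ (Fin-Vec-↩ 6 (2 ^ s)) (Fin-Vec-↩ 5 (2 ^ s)))
      (Fin-×-↩ (↩-id Bit) (Fin-×-↩ (↩-id Bit) (↩-id Bit))))
    -- The oldest buffered digit `d₂` enters the residues and `b` joins the buffer.
    (λ (y , d₂ , d₁ , d₀) b → reduceState (step (liftState y) d₂) , d₁ , d₀ , b)
    (reduceState s₀ , zero , zero , zero)
    (λ (y , d₂ , d₁ , d₀) → eval (form d₂ d₁ d₀) (liftState y) mod2^ s)
    Reads
    -- The buffer starts as three leading zeros, so the run begins at n = 0 with k = 0.
    (0 , s₀ , tracks-0 , refl , refl)
    (λ { {a = _ , d₂ , d₁ , d₀} (k , z , t , refl , refl) b →
         toℕ d₂ + k * 2 , step z d₂ , tracks-step t d₂ , step-mod2^ z d₂ , refl })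
    (λ n → odd (t₆ n) mod2^ s)
    (λ { {a = _ , d₂ , d₁ , d₀} (k , z , t , refl , refl) →
         trans (eval-mod2^ (form d₂ d₁ d₀) z) (cong (_mod2^ s) (sym (odd-t₆ t d₂ d₁ d₀))) })

theorem1p4 : (∀ (n : ℕ) → ν₂ (t₆ n) ≡ ν₂ (+ ((n + 5) C 5)) +⁺ [ 𝟏 (n % 4 ≟ 3) ])
    × (∀ (s : ℕ) → 1 ≤ s → Is2Automatic (λ n → odd (t₆ n) mod2^ s))
theorem1p4 = valuation , λ s _ → odd-t₆-automatic s
  where
  valuation : ∀ n → ν₂ (t₆ n) ≡ ν₂ (+ ((n + 5) C 5)) +⁺ [ 𝟏 (n % 4 ℕ.≟ 3) ]
  valuation n = let k , d₂ , d₁ , d₀ , n≡ = last-three-bits n in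
    subst (λ n → ν₂ (t₆ n) ≡ ν₂ (+ ((n + 5) C 5)) +⁺ [ 𝟏 (n % 4 ℕ.≟ 3) ]) (sym n≡)
      (ν₂-t₆ (proj₂ (tracked k)) d₂ d₁ d₀)
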